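{- Let $n\ge1$ and let $\pi,\sigma\in\mathfrak{B}_n$ have respective length vectors $(\ell_1,\ell_2,\ell_3,\ell_4)$ and $(m_1,m_2,m_3,m_4)$, with $\pi\le\sigma$. Let $d_i=|\ell_i-m_i|+1$ for $i\in\{1,2,3,4\}$, and let $\mu$ be the M\"obius function of $(\mathfrak{B}_n,\le)$. Then: (1) if $d_1=d_2=d_3=d_4=1$, then $\mu(\pi,\sigma)=1$; (2) if $d_1+d_4=d_2+d_3=3$, then $\mu(\pi,\sigma)=-1$; (3) if $d_1=d_2=d_3=d_4=2$, then $\mu(\pi,\sigma)=3$; (4) if $d_1=d_2=d_3=d_4=a\ge 3$, then $\mu(\pi,\sigma)=4$; (5) if for some $a\ge2$ we have $d_1=d_4=a$ and $d_2=a\pm1$, $d_3=a\mp1$, or if for some $a\ge 2$ we have $d_2=d_3=a$ and $d_1=a\pm1$, $d_4=a\mp1$, then $\mu(\pi,\sigma)=1$; (6) if for some $a\ge2$ exactly one of $d_1,d_4$ equals $a$, exactly one of $d_2,d_3$ equals $a$, and the other two values equal $a+1$, then $\mu(\pi,\sigma)=-2$; (7) if $(d_1,d_2,d_3,d_4)$ satisfies none of the six hypotheses in items (1)-(6) of this list, then $\mu(\pi,\sigma)=0$.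
   Context: $\mathfrak{S}_n$ is the set of permutations of $[n]=\{1,\dots,n\}$, in one-line notation. A reduction of $\omega\in\mathfrak{S}_n$ interchanges $\omega(i)$ and $\omega(j)$ for some $i<j$ with $\omega(i)>\omega(j)$. Bruhat order: $\pi\le\sigma$ if $\pi$ is obtained from $\sigma$ by a (possibly empty) sequence of reductions. $\mathfrak{B}_n\subseteq\mathfrak{S}_n$ is the set of bigrassmannian permutations (both $\omega$ and $\omega^{ -1}$ have exactly one descent), with the order inherited from Bruhat order; equivalently $\omega=1\cdots a\,(b+1)\cdots c\,(a+1)\cdots b\,(c+1)\cdots n$ for a unique triple $0\le a<b<c\le n$. The length vector of such an element is $(\ell_1,\ell_2,\ell_3,\ell_4)=(a+1,b-a,c-b,n+1-c)$. The M\"obius function is defined recursively by $\mu(\pi,\pi)=1$ and $\mu(\pi,\sigma)=-\sum_{\tau\in\mathfrak{B}_n:\ \pi\le\tau<\sigma}\mu(\pi,\tau)$ for $\pi<\sigma$. -}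

module Defs where

open import Data.Fin.Base as Fin using (Fin; zero; suc; toℕ)
import Data.Fin.Induction as Fin
import Data.Fin.Properties as Fin
open import Data.Fin.Permutation as Perm
  using (Permutation′; _⟨$⟩ʳ_; _⟨$⟩ˡ_; _∘ₚ_; transpose; flip; insert; remove; inverseˡ; inverseʳ)
  renaming (_≈_ to _≈ₚ_)
open import Data.Integer.Base as ℤ using (ℤ; 0ℤ; 1ℤ)
open import Data.List.Base as List using (List; []; _∷_; _++_)
open import Data.List.Membership.Propositional.Properties using (∈-allFin)
import Data.List.Membership.Setoid.Properties as Membership
open import Data.List.Relation.Unary.All as All using (All; []; _∷_)
open import Data.List.Relation.Unary.AllPairs as AllPairs using (AllPairs; []; _∷_)
open import Data.List.Relation.Unary.Any as Any using (Any; here; there)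
import Data.List.Relation.Unary.Unique.Propositional.Properties as UniqueP
import Data.List.Relation.Unary.Unique.Setoid.Properties as Unique
open import Data.Nat.Base as ℕ using (ℕ; suc; _∸_)
import Data.Nat.Properties as ℕ
open import Data.Product using (Σ; ∃; ∃₂; ∃!; _×_; _,_; proj₁; proj₂)
open import Data.Sum.Base using (_⊎_; inj₁; inj₂)
open import Data.Vec.Base as Vec using (Vec)
import Data.Vec.Properties as Vec
import Data.Vec.Relation.Binary.Lex.Strict as Lex
open import Function.Base using (_∘_; _on_)
open import Induction.WellFounded using (WellFounded; Acc; acc; module Subrelation)
open import Level using (0ℓ)
open import Relation.Binary using (DecPoset; Setoid; StrictPartialOrder; Rel)
open import Relation.Binary.Structures using (IsEquivalence)
import Relation.Binary.Construct.NonStrictToStrict as ToStrict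
import Relation.Binary.Construct.On as On
open import Relation.Binary.PropositionalEquality
  using (_≡_; _≢_; refl; sym; trans; cong; cong₂; subst; subst₂; setoid; module ≡-Reasoning)
open import Relation.Nullary using (¬_; Dec; yes; no; contradiction)
open import Relation.Nullary.Decidable using (map′; _×-dec_; _→-dec_)
open import Relation.Unary using (Pred; Decidable)

module _ {A : Set} {P : Pred A 0ℓ} (P? : Decidable P) where

  select : List A → List (∃ P)
  select []       = []
  select (x ∷ xs) with P? x
  ... | yes p = (x , p) ∷ select xs
  ... | no  _ = select xs

  select-any : {Q : Pred A 0ℓ} → (∀ {x} → Q x → P x) →
               ∀ {xs} → Any Q xs → Any (Q ∘ proj₁) (select xs)
  select-any Q⊆P {x ∷ xs} Qxs with P? x | Qxs
  ... | yes p | here q  = here q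
  ... | yes p | there r = there (select-any Q⊆P r)
  ... | no ¬p | here q  = contradiction (Q⊆P q) ¬p
  ... | no ¬p | there r = select-any Q⊆P r

  select-all : {Q : Pred A 0ℓ} → ∀ {xs} → All Q xs → All (Q ∘ proj₁) (select xs)
  select-all []                   = []
  select-all {xs = x ∷ _} (q ∷ qs) with P? x
  ... | yes _ = q ∷ select-all qs
  ... | no  _ = select-all qs

  select-allPairs : {R : Rel A 0ℓ} → ∀ {xs} →
                    AllPairs R xs → AllPairs (R on proj₁) (select xs)
  select-allPairs []                   = []
  select-allPairs {xs = x ∷ _} (r ∷ rs) with P? x
  ... | yes _ = select-all r ∷ select-allPairs rs
  ... | no  _ = select-allPairs rs

sumℤ : List ℤ → ℤ
sumℤ = List.foldr ℤ._+_ 0ℤ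

-- Well-foundedness follows from finiteness, but carrying it as a field
-- lets μ below be defined by recursion on it.
record FinitePoset : Set₁ where
  field
    decPoset : DecPoset 0ℓ 0ℓ 0ℓ
  open DecPoset decPoset public
  open ToStrict _≈_ _≤_ public using (_<_)
  field
    elements      : List Carrier
    complete      : ∀ x → Any (x ≈_) elements
    unique        : AllPairs (λ x y → ¬ x ≈ y) elements
    <-wellFounded : WellFounded _<_

  _<?_ : ∀ x y → Dec (x < y)
  _<?_ = ToStrict.<-decidable _≈_ _≤_ _≟_ _≤?_

module Möbius (P : FinitePoset) where
  open FinitePoset P using (Carrier; _≈_; _≤_; _<_; _≟_; _≤?_; _<?_; elements; <-wellFounded)

  [_,_⟩ : ∀ x y → List (∃ λ z → x ≤ z × z < y)
  [ x , y ⟩ = select (λ z → (x ≤? z) ×-dec (z <? y)) elements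

  private
    μ-acc : ∀ x y → Acc _<_ y → ℤ
    μ-acc x y (acc rec) with x ≟ y
    ... | yes _ = 1ℤ
    ... | no  _ = ℤ.- sumℤ (List.map (λ { (z , _ , z<y) → μ-acc x z (rec z<y) }) [ x , y ⟩)

    μ-acc-irrelevant : ∀ x y (p q : Acc _<_ y) → μ-acc x y p ≡ μ-acc x y q
    μ-acc-irrelevant x y (acc p) (acc q) with x ≟ y
    ... | yes _ = refl
    ... | no  _ = cong (λ l → ℤ.- sumℤ l) (go [ x , y ⟩)
      where
      go : ∀ zs → List.map (λ { (z , _ , z<y) → μ-acc x z (p z<y) }) zs
                ≡ List.map (λ { (z , _ , z<y) → μ-acc x z (q z<y) }) zs
      go []                   = refl
      go ((z , _ , z<y) ∷ zs) = cong₂ _∷_ (μ-acc-irrelevant x z (p z<y) (q z<y)) (go zs)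

  -- Since [ x , y ⟩ is empty when x ≰ y, μ x y is 0 in that case.
  μ : Carrier → Carrier → ℤ
  μ x y = μ-acc x y (<-wellFounded y)

  μ-≈ : ∀ {x y} → x ≈ y → μ x y ≡ 1ℤ
  μ-≈ {x} {y} x≈y with <-wellFounded y
  ... | acc _ with x ≟ y
  ...   | yes _  = refl
  ...   | no x≉y = contradiction x≈y x≉y

  μ-≉ : ∀ {x y} → ¬ x ≈ y → μ x y ≡ ℤ.- sumℤ (List.map (μ x ∘ proj₁) [ x , y ⟩)
  μ-≉ {x} {y} x≉y with <-wellFounded y
  ... | acc rec with x ≟ y
  ...   | yes x≈y = contradiction x≈y x≉y
  ...   | no  _   = cong (λ l → ℤ.- sumℤ l) (go [ x , y ⟩)
    where
    go : ∀ zs → List.map (λ { (z , _ , z<y) → μ-acc x z (rec z<y) }) zs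
              ≡ List.map (μ x ∘ proj₁) zs
    go []                   = refl
    go ((z , _ , z<y) ∷ zs) =
      cong₂ _∷_ (μ-acc-irrelevant x z (rec z<y) (<-wellFounded z)) (go zs)

-- Positions and values live in Fin n, i.e. they are shifted down by one
-- from {1,…,n}.  Permutations are compared pointwise, by _≈ₚ_.

private variable
  n : ℕ

≈ₚ-isEquivalence : IsEquivalence (_≈ₚ_ {n} {n})
≈ₚ-isEquivalence = record
  { refl  = λ _ → refl
  ; sym   = λ p i → sym (p i)
  ; trans = λ p q i → trans (p i) (q i)
  }

permSetoid : ℕ → Setoid 0ℓ 0ℓ
permSetoid n = record { isEquivalence = ≈ₚ-isEquivalence {n} }

_≟ₚ_ : (π σ : Permutation′ n) → Dec (π ≈ₚ σ)
π ≟ₚ σ = Fin.all? (λ i → π ⟨$⟩ʳ i Fin.≟ σ ⟨$⟩ʳ i)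

permutations : ∀ n → List (Permutation′ n)
permutations 0       = Perm.id ∷ []
permutations (suc n) = List.cartesianProductWith (insert zero) (List.allFin (suc n)) (permutations n)

insert-cong : ∀ {i j : Fin (suc n)} {π σ : Permutation′ n} →
              i ≡ j → π ≈ₚ σ → insert zero i π ≈ₚ insert zero j σ
insert-cong refl π≈σ zero    = refl
insert-cong refl π≈σ (suc k) = cong (Fin.punchIn _) (π≈σ k)

insert-injective : ∀ {i j : Fin (suc n)} {π σ : Permutation′ n} →
                   insert zero i π ≈ₚ insert zero j σ → i ≡ j × π ≈ₚ σ
insert-injective {i = i} p with refl ← p zero = refl , λ k → Fin.punchIn-injective i _ _ (p (suc k))

permutations-complete : (π : Permutation′ n) → Any (π ≈ₚ_) (permutations n)
permutations-complete {0}     π = here λ ()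
permutations-complete {suc n} π = Any.map
  (λ p i → trans (sym (Perm.insert-remove zero π i)) (p i))
  (Membership.∈-cartesianProductWith⁺ (setoid (Fin (suc n))) (permSetoid n) (permSetoid (suc n))
    {f = insert zero} (λ {i} {j} {ρ} {τ} → insert-cong {i = i} {j} {ρ} {τ})
    (∈-allFin (π ⟨$⟩ʳ zero)) (permutations-complete (remove zero π)))

permutations-unique : ∀ n → AllPairs (λ π σ → ¬ π ≈ₚ σ) (permutations n)
permutations-unique 0       = [] ∷ []
permutations-unique (suc n) =
  Unique.cartesianProductWith⁺ (setoid (Fin (suc n))) (permSetoid n) (permSetoid (suc n))
    (insert zero) (λ {i} {j} {π} {σ} → insert-injective {i = i} {j} {π} {σ})
    (UniqueP.allFin⁺ (suc n)) (permutations-unique n)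

-- transpose i j ∘ₚ σ applies the transposition first, so it is σ with the
-- entries in positions i and j interchanged.
_↘_ : Rel (Permutation′ n) 0ℓ
σ ↘ ρ = ∃₂ λ i j → i Fin.< j × σ ⟨$⟩ʳ j Fin.< σ ⟨$⟩ʳ i × ρ ≈ₚ (transpose i j ∘ₚ σ)

infix 4 _↘_ _≤ᴮ_

data _≤ᴮ_ (π : Permutation′ n) : Permutation′ n → Set where
  done   : ∀ {σ} → π ≈ₚ σ → π ≤ᴮ σ
  reduce : ∀ {σ ρ} → σ ↘ ρ → π ≤ᴮ ρ → π ≤ᴮ σ

↘-respˡ : ∀ {σ σ′ ρ : Permutation′ n} → σ ≈ₚ σ′ → σ ↘ ρ → σ′ ↘ ρ
↘-respˡ σ≈σ′ (i , j , i<j , σj<σi , ρ≈) =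
  i , j , i<j , subst₂ Fin._<_ (σ≈σ′ j) (σ≈σ′ i) σj<σi , λ k → trans (ρ≈ k) (σ≈σ′ _)

≤ᴮ-respʳ : ∀ {π σ σ′ : Permutation′ n} → σ ≈ₚ σ′ → π ≤ᴮ σ → π ≤ᴮ σ′
≤ᴮ-respʳ e (done p)                   = done λ i → trans (p i) (e i)
≤ᴮ-respʳ {σ = σ} {σ′} e (reduce {ρ = ρ} s p) = reduce (↘-respˡ {σ = σ} {σ′} {ρ} e s) p

≤ᴮ-trans : ∀ {π σ τ : Permutation′ n} → π ≤ᴮ σ → σ ≤ᴮ τ → π ≤ᴮ τ
≤ᴮ-trans p (done e)     = ≤ᴮ-respʳ e p
≤ᴮ-trans p (reduce s q) = reduce s (≤ᴮ-trans p q)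

-- A reduction makes the one-line word lexicographically smaller; this gives
-- antisymmetry, decidability and well-foundedness of the Bruhat order.

module Word (n : ℕ) = StrictPartialOrder (Lex.<-strictPartialOrder (Fin.<-strictPartialOrder n) n)

word : Permutation′ n → Vec (Fin n) n
word π = Vec.tabulate (π ⟨$⟩ʳ_)

_≺_ : Rel (Permutation′ n) 0ℓ
_≺_ {n} = Word._<_ n on word

≺-wellFounded : WellFounded (_≺_ {n})
≺-wellFounded =
  On.wellFounded word (Lex.<-wellFounded trans (λ { refl p → p }) Fin.<-wellFounded)

tabulate-lex : ∀ {m k} (f g : Fin k → Fin m) (i : Fin k) →
               (∀ j → j Fin.< i → f j ≡ g j) → f i Fin.< g i →
               Lex.Lex-< _≡_ Fin._<_ (Vec.tabulate f) (Vec.tabulate g)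
tabulate-lex f g zero    eq lt = Lex.this lt refl
tabulate-lex f g (suc i) eq lt =
  Lex.next (eq zero ℕ.z<s) (tabulate-lex (f ∘ suc) (g ∘ suc) i (λ j j<i → eq (suc j) (ℕ.s<s j<i)) lt)

transpose-left : ∀ (i j : Fin n) → transpose i j ⟨$⟩ʳ i ≡ j
transpose-left i j with i Fin.≟ i
... | yes _  = refl
... | no i≢i = contradiction refl i≢i

transpose-other : ∀ (i j k : Fin n) → k ≢ i → k ≢ j → transpose i j ⟨$⟩ʳ k ≡ k
transpose-other i j k k≢i k≢j with k Fin.≟ i
... | yes k≡i = contradiction k≡i k≢i
... | no  _ with k Fin.≟ j
...   | yes k≡j = contradiction k≡j k≢j
...   | no  _   = refl

↘⇒≻ : ∀ {σ ρ : Permutation′ n} → σ ↘ ρ → ρ ≺ σ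
↘⇒≻ {σ = σ} {ρ} (i , j , i<j , σj<σi , ρ≈) = tabulate-lex (ρ ⟨$⟩ʳ_) (σ ⟨$⟩ʳ_) i
  (λ k k<i → trans (ρ≈ k) (cong (σ ⟨$⟩ʳ_)
    (transpose-other i j k (Fin.<⇒≢ k<i) (Fin.<⇒≢ (Fin.<-trans k<i i<j)))))
  (subst (Fin._< σ ⟨$⟩ʳ i) (sym (trans (ρ≈ i) (cong (σ ⟨$⟩ʳ_) (transpose-left i j)))) σj<σi)

≤ᴮ⇒≈⊎≺ : ∀ {π σ : Permutation′ n} → π ≤ᴮ σ → π ≈ₚ σ ⊎ π ≺ σ
≤ᴮ⇒≈⊎≺ (done π≈σ) = inj₁ π≈σ
≤ᴮ⇒≈⊎≺ {n} {π} {σ} (reduce {ρ = ρ} s p) with ≤ᴮ⇒≈⊎≺ p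
... | inj₁ π≈ρ = inj₂ (subst (λ w → Word._<_ n w (word σ)) (sym (Vec.tabulate-cong π≈ρ)) (↘⇒≻ {σ = σ} {ρ} s))
... | inj₂ π≺ρ = inj₂ (Word.trans n π≺ρ (↘⇒≻ {σ = σ} {ρ} s))

≤ᴮ-antisym : ∀ {π σ : Permutation′ n} → π ≤ᴮ σ → σ ≤ᴮ π → π ≈ₚ σ
≤ᴮ-antisym {n} p q with ≤ᴮ⇒≈⊎≺ p | ≤ᴮ⇒≈⊎≺ q
... | inj₁ e | _      = e
... | inj₂ _ | inj₁ e = λ i → sym (e i)
... | inj₂ l | inj₂ g = contradiction g (Word.asym n l)

private
  ≤ᴮ?-acc : (π σ : Permutation′ n) → Acc _≺_ σ → Dec (π ≤ᴮ σ)
  ≤ᴮ?-acc π σ (acc rec) with π ≟ₚ σ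
  ... | yes π≈σ = yes (done π≈σ)
  ... | no  π≉σ = map′ to from (Fin.any? λ i → Fin.any? λ j → step? i j)
    where
    Step : Fin _ → Fin _ → Set
    Step i j = Σ (i Fin.< j × σ ⟨$⟩ʳ j Fin.< σ ⟨$⟩ʳ i) λ _ → π ≤ᴮ transpose i j ∘ₚ σ

    step? : ∀ i j → Dec (Step i j)
    step? i j with i Fin.<? j ×-dec (σ ⟨$⟩ʳ j Fin.<? σ ⟨$⟩ʳ i)
    ... | no ¬s = no (¬s ∘ proj₁)
    ... | yes s@(i<j , σj<σi) =
      map′ (s ,_) proj₂ (≤ᴮ?-acc π (transpose i j ∘ₚ σ)
        (rec (↘⇒≻ {σ = σ} {transpose i j ∘ₚ σ} (i , j , i<j , σj<σi , λ _ → refl))))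

    to : (∃₂ λ i j → Step i j) → π ≤ᴮ σ
    to (i , j , (i<j , σj<σi) , p) = reduce (i , j , i<j , σj<σi , λ _ → refl) p

    from : π ≤ᴮ σ → ∃₂ λ i j → Step i j
    from (done π≈σ)                             = contradiction π≈σ π≉σ
    from (reduce (i , j , i<j , σj<σi , ρ≈) p) = i , j , (i<j , σj<σi) , ≤ᴮ-respʳ ρ≈ p

_≤ᴮ?_ : (π σ : Permutation′ n) → Dec (π ≤ᴮ σ)
π ≤ᴮ? σ = ≤ᴮ?-acc π σ (≺-wellFounded σ)

bruhat : ℕ → DecPoset 0ℓ 0ℓ 0ℓ
bruhat n = record
  { Carrier = Permutation′ n
  ; _≈_     = _≈ₚ_
  ; _≤_     = _≤ᴮ_
  ; isDecPartialOrder = record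
    { isPartialOrder = record
      { isPreorder = record
        { isEquivalence = ≈ₚ-isEquivalence
        ; reflexive     = done
        ; trans         = ≤ᴮ-trans
        }
      ; antisym = ≤ᴮ-antisym
      }
    ; _≟_  = _≟ₚ_
    ; _≤?_ = _≤ᴮ?_
    }
  }

Descent : Permutation′ n → Fin n → Set
Descent ω i = ∃ λ j → toℕ j ≡ suc (toℕ i) × ω ⟨$⟩ʳ j Fin.< ω ⟨$⟩ʳ i

OneDescent : Permutation′ n → Set
OneDescent ω = ∃! _≡_ (Descent ω)

Bigrassmannian : Permutation′ n → Set
Bigrassmannian ω = OneDescent ω × OneDescent (flip ω)

descent? : (ω : Permutation′ n) → Decidable (Descent ω)
descent? ω i = Fin.any? λ j → (toℕ j ℕ.≟ suc (toℕ i)) ×-dec (ω ⟨$⟩ʳ j Fin.<? ω ⟨$⟩ʳ i)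

oneDescent? : Decidable (OneDescent {n})
oneDescent? ω = map′ (λ { (i , d , u) → i , d , u _ }) (λ { (i , d , u) → i , d , λ _ → u })
  (Fin.any? λ i → descent? ω i ×-dec Fin.all? λ j → descent? ω j →-dec (i Fin.≟ j))

bigrassmannian? : Decidable (Bigrassmannian {n})
bigrassmannian? ω = oneDescent? ω ×-dec oneDescent? (flip ω)

descent-resp : {ω ω′ : Permutation′ n} → ω ≈ₚ ω′ → ∀ {i} → Descent ω i → Descent ω′ i
descent-resp e (j , j≡ , lt) = j , j≡ , subst₂ Fin._<_ (e _) (e _) lt

oneDescent-resp : {ω ω′ : Permutation′ n} → ω ≈ₚ ω′ → OneDescent ω → OneDescent ω′
oneDescent-resp {ω = ω} {ω′} e (i , d , u) =
  i , descent-resp {ω = ω} {ω′} e d , λ d′ → u (descent-resp {ω = ω′} {ω} (λ k → sym (e k)) d′)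

flip-cong : {ω ω′ : Permutation′ n} → ω ≈ₚ ω′ → flip ω ≈ₚ flip ω′
flip-cong {ω = ω} {ω′} e k = begin
  ω ⟨$⟩ˡ k                      ≡⟨ cong (ω ⟨$⟩ˡ_) (inverseʳ ω′) ⟨
  ω ⟨$⟩ˡ (ω′ ⟨$⟩ʳ (ω′ ⟨$⟩ˡ k))  ≡⟨ cong (ω ⟨$⟩ˡ_) (e _) ⟨
  ω ⟨$⟩ˡ (ω ⟨$⟩ʳ (ω′ ⟨$⟩ˡ k))   ≡⟨ inverseˡ ω ⟩
  ω′ ⟨$⟩ˡ k                     ∎
  where open ≡-Reasoning

bigrassmannian-resp : {ω ω′ : Permutation′ n} → ω ≈ₚ ω′ → Bigrassmannian ω → Bigrassmannian ω′
bigrassmannian-resp {ω = ω} {ω′} e (p , q) =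
  oneDescent-resp {ω = ω} {ω′} e p ,
  oneDescent-resp {ω = flip ω} {flip ω′} (flip-cong {ω = ω} {ω′} e) q

-- The order and the equality ignore the bigrassmannian proof.
𝔅 : ℕ → FinitePoset
𝔅 n = record
  { decPoset      = On.decPoset (bruhat n) (proj₁ {B = Bigrassmannian})
  ; elements      = select bigrassmannian? (permutations n)
  ; complete      = λ { (ω , b) → select-any bigrassmannian?
                      (λ {ω′} e → bigrassmannian-resp {ω = ω} {ω′} e b) (permutations-complete ω) }
  ; unique        = select-allPairs bigrassmannian? (permutations-unique n)
  ; <-wellFounded = Subrelation.wellFounded (λ {π} {σ} → <⇒≺ {π} {σ}) (On.wellFounded proj₁ {∼ = _≺_} ≺-wellFounded)
  }
  where
  <⇒≺ : ∀ {π σ : ∃ Bigrassmannian} →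
        proj₁ π ≤ᴮ proj₁ σ × ¬ (proj₁ π ≈ₚ proj₁ σ) → proj₁ π ≺ proj₁ σ
  <⇒≺ (π≤σ , π≉σ) with ≤ᴮ⇒≈⊎≺ π≤σ
  ... | inj₁ π≈σ = contradiction π≈σ π≉σ
  ... | inj₂ π≺σ = π≺σ

-- Entries are numbered from 1, as on paper.
oneLine : Permutation′ n → List ℕ
oneLine ω = List.tabulate (λ i → suc (toℕ (ω ⟨$⟩ʳ i)))

-- ⟨ a ⋯ b ] is the increasing list a+1, a+2, …, b.
⟨_⋯_] : ℕ → ℕ → List ℕ
⟨ a ⋯ b ] = List.applyUpTo (λ k → suc (a ℕ.+ k)) (b ∸ a)

HasLengthVector : Permutation′ n → (ℓ₁ ℓ₂ ℓ₃ ℓ₄ : ℕ) → Set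
HasLengthVector {n} ω ℓ₁ ℓ₂ ℓ₃ ℓ₄ = ∃ λ a → ∃₂ λ b c →
  a ℕ.< b × b ℕ.< c × c ℕ.≤ n ×
  oneLine ω ≡ ⟨ 0 ⋯ a ] ++ ⟨ b ⋯ c ] ++ ⟨ a ⋯ b ] ++ ⟨ c ⋯ n ] ×
  ℓ₁ ≡ a ℕ.+ 1 × ℓ₂ ≡ b ∸ a × ℓ₃ ≡ c ∸ b × ℓ₄ ≡ (n ℕ.+ 1) ∸ c

module _ (d₁ d₂ d₃ d₄ : ℕ) where
  open import Data.Nat.Base using (_+_; _≤_)

  AllEqual : ℕ → Set
  AllEqual a = d₁ ≡ a × d₂ ≡ a × d₃ ≡ a × d₄ ≡ a

  Case₁ Case₂ Case₃ Case₄ Case₅ Case₆ : Set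

  Case₁ = AllEqual 1

  Case₂ = d₁ + d₄ ≡ 3 × d₂ + d₃ ≡ 3

  Case₃ = AllEqual 2

  Case₄ = ∃ λ a → 3 ≤ a × AllEqual a

  Case₅ =
    (∃ λ a → 2 ≤ a × d₁ ≡ a × d₄ ≡ a × ((d₂ ≡ a + 1 × d₃ ≡ a ∸ 1) ⊎ (d₂ ≡ a ∸ 1 × d₃ ≡ a + 1))) ⊎
    (∃ λ a → 2 ≤ a × d₂ ≡ a × d₃ ≡ a × ((d₁ ≡ a + 1 × d₄ ≡ a ∸ 1) ⊎ (d₁ ≡ a ∸ 1 × d₄ ≡ a + 1)))

  Case₆ = ∃ λ a → 2 ≤ a ×
    ((d₁ ≡ a × d₄ ≡ a + 1) ⊎ (d₁ ≡ a + 1 × d₄ ≡ a)) ×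
    ((d₂ ≡ a × d₃ ≡ a + 1) ⊎ (d₂ ≡ a + 1 × d₃ ≡ a))

{-# OPTIONS --safe #-}
-- A bigrassmannian permutation swaps two adjacent blocks of h = ℓ₂ and k = ℓ₃ values.
-- Fixed prefix, fixed suffix and the largest displacements to either side are monotone
-- along reductions, and conversely two inclusions of inversion sets (one after passing to
-- inverses) give a chain of reductions; hence π ≤ σ iff ℓ₁ ≥ m₁, ℓ₂ ≤ m₂, ℓ₃ ≤ m₃, ℓ₄ ≥ m₄.
-- So an interval is {x ∈ ℕ⁴ : x₁ + x₄ = x₂ + x₃, x ≤ e}, where eᵢ = dᵢ - 1.  This monoid is
-- generated by (1,1,0,0), (1,0,1,0), (0,1,0,1), (0,0,1,1) with one relation, and its
-- series is (1 - z₁z₂z₃z₄) / ((1 - z₁z₂)(1 - z₁z₃)(1 - z₂z₄)(1 - z₃z₄)); the values of μ are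
-- the coefficients of the reciprocal.
module Submission where

open import Defs
open import Algebra.Properties.CommutativeSemigroup using (interchange)
open import Data.Bool.Base using (if_then_else_)
open import Data.Fin.Base as Fin using (Fin; toℕ; fromℕ<)
open import Data.Fin.Permutation
  using (Permutation′; permutation; _⟨$⟩ʳ_; _⟨$⟩ˡ_; _∘ₚ_; transpose; flip; inverseˡ; inverseʳ)
  renaming (_≈_ to _≈ₚ_)
import Data.Fin.Properties as Fin
open import Data.Integer.Base using (ℤ; +_; -_; 0ℤ; 1ℤ) renaming (_+_ to _+ᶻ_)
import Data.Integer.Properties as ℤ
open import Data.List.Base as List using (List; []; _∷_; _++_; applyUpTo)
open import Data.List.Membership.Propositional using (_∈_)
open import Data.List.Membership.Propositional.Properties using (∈-map⁻)
import Data.List.Properties as List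
open import Data.List.Relation.Unary.All as All using (All; []; _∷_)
import Data.List.Relation.Unary.All.Properties as All
open import Data.List.Relation.Unary.AllPairs as AllPairs using ([]; _∷_)
import Data.List.Relation.Unary.AllPairs.Properties as AllPairs
open import Data.List.Relation.Unary.Any as Any using (here; there; any?)
import Data.List.Relation.Unary.Any.Properties as Any
open import Data.List.Relation.Unary.Unique.Propositional using (Unique)
open import Data.Maybe.Base using (Maybe; just; nothing; maybe)
open import Data.Nat.Base
  using (ℕ; zero; suc; 2+; _≤_; _<_; _+_; _∸_; ∣_-_∣; z≤n; s≤s; s≤s⁻¹; z<s; s<s)
import Data.Nat.Properties as ℕ
open import Data.Nat.Tactic.RingSolver using (solve-∀)
open import Data.Product using (Σ; _×_; _,_; proj₁; proj₂; ∃; ∃₂)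
open import Data.Product.Properties using (≡-dec)
open import Data.Sum.Base using (_⊎_; inj₁; inj₂)
open import Function.Base using (_∘_; id)
open import Induction.WellFounded using (Acc; acc)
open import Relation.Binary.Definitions using (tri<; tri≈; tri>)
open import Relation.Binary.PropositionalEquality
  using (_≡_; _≢_; _≗_; refl; sym; trans; cong; cong₂; subst; subst₂; module ≡-Reasoning)
open import Relation.Nullary using (¬_; Dec; does; yes; no; contradiction)
open import Relation.Nullary.Decidable using (_×-dec_; decidable-stable)

-- A reduction of a bigrassmannian permutation need not be bigrassmannian, so `≤ᴮ` cannot be
-- analysed inside 𝔅. Hence one direction uses statistics defined for every permutation, and the
-- other the weak order, where a single adjacent swap can be controlled. Since an interval depends
-- only on e, μ is the convolution inverse of the constant function 1 on the monoid, that is, the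
-- reciprocal of its series. The one relation is (1,1,0,0) + (0,0,1,1) = (1,0,1,0) + (0,1,0,1), both
-- sides being (1,1,1,1). Dividing by 1 - z₁z₂z₃z₄ therefore adds up the coefficients of the product
-- of the four factors along the diagonal x, x - (1,1,1,1), and so on. The list of cases is read off
-- from these diagonals. The one through 0 meets the coefficients 1, 2, 1 and gives 1, 3, 4, 4, ...;
-- the one through a generator meets -1, -1 and gives -1, -2, -2, ...; the one through an exponent
-- like (2,1,1,0) meets a single 1 and stays at 1; every other diagonal gives 0.

private variable
  n : ℕ
  A : Set

-- Weak order and inversion

⟨$⟩ʳ-injective : (π : Permutation′ n) → ∀ {i j} → π ⟨$⟩ʳ i ≡ π ⟨$⟩ʳ j → i ≡ j
⟨$⟩ʳ-injective π e = trans (sym (inverseˡ π)) (trans (cong (π ⟨$⟩ˡ_) e) (inverseˡ π))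

data Transposed (i j : Fin n) : Fin n → Fin n → Set where
  left  : Transposed i j i j
  right : Transposed i j j i
  other : ∀ {k} → k ≢ i → k ≢ j → Transposed i j k k

transposed : ∀ (i j k : Fin n) → Transposed i j k (transpose i j ⟨$⟩ʳ k)
transposed i j k with k Fin.≟ i
... | yes refl = left
... | no  k≢i with k Fin.≟ j
...   | yes refl = right
...   | no  k≢j  = other k≢i k≢j

transposed-functional : ∀ {i j k x y : Fin n} → Transposed i j k x → Transposed i j k y → x ≡ y
transposed-functional left          left          = refl
transposed-functional left          right         = refl
transposed-functional right         left          = refl
transposed-functional right         right         = refl
transposed-functional (other _ _)   (other _ _)   = refl
transposed-functional left          (other k≢i _) = contradiction refl k≢i
transposed-functional right         (other _ k≢j) = contradiction refl k≢j
transposed-functional (other k≢i _) left          = contradiction refl k≢i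
transposed-functional (other _ k≢j) right         = contradiction refl k≢j

transposed-swap : ∀ {i j x y : Fin n} → Transposed j i x y → Transposed i j x y
transposed-swap left            = right
transposed-swap right           = left
transposed-swap (other k≢j k≢i) = other k≢i k≢j

transposed-map : ∀ (σ : Permutation′ n) {i j x y} → Transposed i j x y →
                 Transposed (σ ⟨$⟩ʳ i) (σ ⟨$⟩ʳ j) (σ ⟨$⟩ʳ x) (σ ⟨$⟩ʳ y)
transposed-map σ left            = left
transposed-map σ right           = right
transposed-map σ (other k≢i k≢j) = other (k≢i ∘ ⟨$⟩ʳ-injective σ) (k≢j ∘ ⟨$⟩ʳ-injective σ)

-- No position lies strictly between two neighbours, so exchanging them disturbs the relative order
-- of no other pair. Hence the swap of an adjacent descent loses exactly one inversion.
transposed-mono : ∀ {i j : Fin n} → toℕ j ≡ suc (toℕ i) → ∀ {x x′ y y′} →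
                  Transposed i j x x′ → Transposed i j y y′ →
                  x Fin.< y → ¬ (x ≡ i × y ≡ j) → x′ Fin.< y′
transposed-mono j≡ left            left            x<y ¬xy = contradiction x<y (ℕ.<-irrefl refl)
transposed-mono j≡ left            right           x<y ¬xy = contradiction (refl , refl) ¬xy
transposed-mono j≡ left            (other _ y≢j)   x<y ¬xy =
  ℕ.≤∧≢⇒< (subst (_≤ _) (sym j≡) x<y) (y≢j ∘ sym ∘ Fin.toℕ-injective)
transposed-mono j≡ right           left            x<y ¬xy = subst (_ <_) (sym j≡) ℕ.≤-refl
transposed-mono j≡ right           right           x<y ¬xy = contradiction x<y (ℕ.<-irrefl refl)
transposed-mono j≡ right           (other _ _)     x<y ¬xy = ℕ.<-trans (subst (_ <_) (sym j≡) ℕ.≤-refl) x<y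
transposed-mono j≡ (other _ _)     left            x<y ¬xy = ℕ.<-trans x<y (subst (_ <_) (sym j≡) ℕ.≤-refl)
transposed-mono j≡ (other x≢i _)   right           x<y ¬xy =
  ℕ.≤∧≢⇒< (s≤s⁻¹ (subst (_ <_) j≡ x<y)) (x≢i ∘ Fin.toℕ-injective)
transposed-mono j≡ (other _ _)     (other _ _)     x<y ¬xy = x<y

Increasing : (Fin n → Fin n) → Set
Increasing f = ∀ i j → toℕ j ≡ suc (toℕ i) → f i Fin.< f j

increasing-gap : {f : Fin n → Fin n} → Increasing f →
                 ∀ k i j → toℕ j ≡ k + toℕ i → k + toℕ (f i) ≤ toℕ (f j)
increasing-gap {f = f} inc zero i j j≡i = ℕ.≤-reflexive (cong (toℕ ∘ f) (Fin.toℕ-injective (sym j≡i)))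
increasing-gap {n} {f} inc (suc k) i j j≡ = ℕ.≤-trans (s≤s (increasing-gap inc k i j′ (Fin.toℕ-fromℕ< lt)))
  (inc j′ j (trans j≡ (cong suc (sym (Fin.toℕ-fromℕ< lt)))))
  where
  lt : k + toℕ i < n
  lt = ℕ.≤-trans (ℕ.≤-reflexive (sym j≡)) (ℕ.<⇒≤ (Fin.toℕ<n j))
  j′ = fromℕ< lt

-- Counting steps up from position 0 bounds `f i` from below by `i`; counting steps up to the last
-- position bounds it from above.
increasing⇒id : {f : Fin n → Fin n} → Increasing f → ∀ i → f i ≡ i
increasing⇒id {suc n} {f} inc i = Fin.toℕ-injective (ℕ.≤-antisym upper lower)
  where
  lower : toℕ i ≤ toℕ (f i)
  lower = ℕ.≤-trans (ℕ.m≤m+n _ _) (increasing-gap inc (toℕ i) Fin.zero i (sym (ℕ.+-identityʳ _)))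
  last = fromℕ< (ℕ.n<1+n n)
  last≡ : toℕ last ≡ n
  last≡ = Fin.toℕ-fromℕ< (ℕ.n<1+n n)
  k = n ∸ toℕ i
  k+i≡n : k + toℕ i ≡ n
  k+i≡n = ℕ.m∸n+n≡m (s≤s⁻¹ (Fin.toℕ<n i))
  upper : toℕ (f i) ≤ toℕ i
  upper = ℕ.+-cancelˡ-≤ k _ _ (ℕ.≤-trans
    (increasing-gap inc k i last (trans last≡ (sym k+i≡n)))
    (subst (toℕ (f last) ≤_) (sym k+i≡n) (s≤s⁻¹ (Fin.toℕ<n (f last)))))

-- The right weak order; inversions are recorded by their values u < v.
_≤ᵂ_ : Permutation′ n → Permutation′ n → Set
π ≤ᵂ σ = ∀ u v → u Fin.< v → π ⟨$⟩ˡ v Fin.< π ⟨$⟩ˡ u → σ ⟨$⟩ˡ v Fin.< σ ⟨$⟩ˡ u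

-- Swap an adjacent descent of σ that is not an inversion of π; if there is
-- none, then π⁻¹σ is increasing.
≤ᵂ⇒≤ᴮ : {π σ : Permutation′ n} → π ≤ᵂ σ → π ≤ᴮ σ
≤ᵂ⇒≤ᴮ {n} {π} {σ} = go σ (≺-wellFounded σ)
  where
  go : ∀ σ → Acc _≺_ σ → π ≤ᵂ σ → π ≤ᴮ σ
  go σ (acc rec) π≤σ with Fin.any? (λ i → Fin.any? (λ j →
    (toℕ j ℕ.≟ suc (toℕ i)) ×-dec ((σ ⟨$⟩ʳ j Fin.<? σ ⟨$⟩ʳ i) ×-dec
      (π ⟨$⟩ˡ (σ ⟨$⟩ʳ j) Fin.<? π ⟨$⟩ˡ (σ ⟨$⟩ʳ i)))))
  ... | yes (i , j , j≡ , σj<σi , π⁻¹<) =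
    reduce {ρ = ρ} σ↘ρ (go ρ (rec (↘⇒≻ {σ = σ} {ρ} σ↘ρ)) π≤ρ)
    where
    ρ = transpose i j ∘ₚ σ
    σ↘ρ : σ ↘ ρ
    σ↘ρ = i , j , subst (toℕ i <_) (sym j≡) ℕ.≤-refl , σj<σi , λ _ → refl
    π≤ρ : π ≤ᵂ ρ
    π≤ρ u v u<v inv =
      transposed-mono j≡ (transposed-swap (transposed j i _)) (transposed-swap (transposed j i _))
      (π≤σ u v u<v inv) λ { (v≡ , u≡) →
        ℕ.<-asym inv (subst₂ (λ x y → π ⟨$⟩ˡ x Fin.< π ⟨$⟩ˡ y)
          (trans (cong (σ ⟨$⟩ʳ_) (sym u≡)) (inverseʳ σ)) (trans (cong (σ ⟨$⟩ʳ_) (sym v≡)) (inverseʳ σ)) π⁻¹<) }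
  ... | no ¬good = done λ i →
    trans (cong (π ⟨$⟩ʳ_) (sym (increasing⇒id inc i))) (inverseʳ π)
    where
    inc : Increasing (λ i → π ⟨$⟩ˡ (σ ⟨$⟩ʳ i))
    inc i j j≡ with Fin.<-cmp (π ⟨$⟩ˡ (σ ⟨$⟩ʳ i)) (π ⟨$⟩ˡ (σ ⟨$⟩ʳ j))
    ... | tri< lt _ _ = lt
    ... | tri≈ _ eq _ = contradiction
      (trans (sym j≡) (cong toℕ (sym (⟨$⟩ʳ-injective σ (⟨$⟩ʳ-injective (flip π) eq))))) ℕ.1+n≢n
    ... | tri> _ _ gt with Fin.<-cmp (σ ⟨$⟩ʳ i) (σ ⟨$⟩ʳ j)
    ...   | tri< σi<σj _ _ = contradiction
      (subst₂ Fin._<_ (inverseˡ σ) (inverseˡ σ) (π≤σ _ _ σi<σj gt))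
      (ℕ.<-asym (subst (toℕ i <_) (sym j≡) ℕ.≤-refl))
    ...   | tri≈ _ eq _ = contradiction
      (trans (sym j≡) (cong toℕ (sym (⟨$⟩ʳ-injective σ eq)))) ℕ.1+n≢n
    ...   | tri> _ _ σj<σi = contradiction (i , j , j≡ , σj<σi , gt) ¬good

-- Exchanging the entries of σ in positions i < j exchanges the entries of σ⁻¹ in positions σ j < σ
-- i. These entries are j and i, hence again an inversion.
↘-flip : {σ ρ : Permutation′ n} → σ ↘ ρ → flip σ ↘ flip ρ
↘-flip {σ = σ} {ρ} (i , j , i<j , σj<σi , ρ≈) =
  σ ⟨$⟩ʳ j , σ ⟨$⟩ʳ i , σj<σi , subst₂ Fin._<_ (sym (inverseˡ σ)) (sym (inverseˡ σ)) i<j , λ k →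
  trans (flip-cong {ω = ρ} {transpose i j ∘ₚ σ} ρ≈ k)
    (trans (sym (inverseˡ σ)) (cong (σ ⟨$⟩ˡ_) (transposed-functional
      (subst (λ m → Transposed (σ ⟨$⟩ʳ j) (σ ⟨$⟩ʳ i) m (σ ⟨$⟩ʳ (transpose j i ⟨$⟩ʳ (σ ⟨$⟩ˡ k)))) (inverseʳ σ)
        (transposed-map σ (transposed j i (σ ⟨$⟩ˡ k))))
      (transposed (σ ⟨$⟩ʳ j) (σ ⟨$⟩ʳ i) k))))

≤ᴮ-flip : {π σ : Permutation′ n} → π ≤ᴮ σ → flip π ≤ᴮ flip σ
≤ᴮ-flip {π = π} {σ} (done π≈σ) = done (flip-cong {ω = π} {σ} π≈σ)
≤ᴮ-flip {σ = σ} (reduce {ρ = ρ} s p) = reduce (↘-flip {σ = σ} {ρ} s) (≤ᴮ-flip p)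

≤ᴮ-flip⁻ : {π σ : Permutation′ n} → flip π ≤ᴮ flip σ → π ≤ᴮ σ
≤ᴮ-flip⁻ p = ≤ᴮ-trans (done λ _ → refl) (≤ᴮ-trans (≤ᴮ-flip p) (done λ _ → refl))

-- Block swaps

+-swap : ∀ m n o → m + n + o ≡ m + o + n
+-swap = solve-∀

-- y is the entry in position x of the word
-- 0 ⋯ a-1, a+h ⋯ a+h+k-1, a ⋯ a+h-1, a+h+k ⋯ .
data BlockSwap (a h k x y : ℕ) : Set where
  below : x < a → y ≡ x → BlockSwap a h k x y
  up    : a ≤ x → x < a + k → y ≡ x + h → BlockSwap a h k x y
  down  : a + k ≤ x → x < a + k + h → x ≡ y + k → BlockSwap a h k x y
  above : a + k + h ≤ x → y ≡ x → BlockSwap a h k x y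

blockSwap-total : ∀ a h k x → ∃ (BlockSwap a h k x)
blockSwap-total a h k x with x ℕ.<? a | x ℕ.<? a + k | x ℕ.<? a + k + h
... | yes x<a | _       | _       = x , below x<a refl
... | no  x≮a | yes x<k | _       = x + h , up (ℕ.≮⇒≥ x≮a) x<k refl
... | no  _   | no  x≮k | yes x<h = x ∸ k , down (ℕ.≮⇒≥ x≮k) x<h
  (sym (ℕ.m∸n+n≡m (ℕ.≤-trans (ℕ.m≤n+m k a) (ℕ.≮⇒≥ x≮k))))
... | no  _   | no  _   | no  x≮h = x , above (ℕ.≮⇒≥ x≮h) refl

blockSwap-sym : ∀ {a h k x y} → BlockSwap a h k x y → BlockSwap a k h y x
blockSwap-sym (below x<a refl) = below x<a refl
blockSwap-sym {a} {h} {k} {x} (up a≤x x<k refl) =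
  down (ℕ.+-monoˡ-≤ h a≤x) (subst (x + h <_) (+-swap a k h) (ℕ.+-monoˡ-< h x<k)) refl
blockSwap-sym {a} {h} {k} {y = y} (down k≤x x<h refl) =
  up (ℕ.+-cancelʳ-≤ k a y k≤x) (ℕ.+-cancelʳ-< k y (a + h) (subst (y + k <_) (+-swap a k h) x<h)) refl
blockSwap-sym {a} {h} {k} {x} (above h≤x refl) = above (subst (_≤ x) (+-swap a k h) h≤x) refl

-- By `blockSwap-inverted` and `blockSwap-mono` these are exactly the inverted pairs of positions.
-- The comparison in the weak order rests on knowing the whole inversion set.
Inverted : (a h k x x′ : ℕ) → Set
Inverted a h k x x′ = a ≤ x × x < a + k × a + k ≤ x′ × x′ < a + k + h

blockSwap-inverted : ∀ {a h k x x′ y y′} → BlockSwap a h k x y → BlockSwap a h k x′ y′ →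
                     Inverted a h k x x′ → y′ < y
blockSwap-inverted (below x<a _) _ (a≤x , _) = contradiction a≤x (ℕ.<⇒≱ x<a)
blockSwap-inverted (down k≤x _ _) _ (_ , x<k , _) = contradiction k≤x (ℕ.<⇒≱ x<k)
blockSwap-inverted {a} {h} {k} (above h≤x _) _ (_ , x<k , _) =
  contradiction (ℕ.≤-trans (ℕ.m≤m+n (a + k) h) h≤x) (ℕ.<⇒≱ x<k)
blockSwap-inverted {a} {h} {k} (up _ _ _) (below x′<a _) (_ , _ , k≤x′ , _) =
  contradiction (ℕ.≤-trans (ℕ.m≤m+n a k) k≤x′) (ℕ.<⇒≱ x′<a)
blockSwap-inverted (up _ _ _) (up _ x′<k _) (_ , _ , k≤x′ , _) = contradiction k≤x′ (ℕ.<⇒≱ x′<k)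
blockSwap-inverted (up _ _ _) (above h≤x′ _) (_ , _ , _ , x′<h) = contradiction h≤x′ (ℕ.<⇒≱ x′<h)
blockSwap-inverted {a} {h} {k} {y′ = y′} (up a≤x _ refl) (down _ x′<h refl) _ =
  ℕ.≤-trans (ℕ.+-cancelʳ-< k y′ (a + h) (subst (y′ + k <_) (+-swap a k h) x′<h)) (ℕ.+-monoˡ-≤ h a≤x)

blockSwap-mono : ∀ {a h k x x′ y y′} → BlockSwap a h k x y → BlockSwap a h k x′ y′ →
                 x < x′ → ¬ Inverted a h k x x′ → y < y′
blockSwap-mono (below _ refl) (below _ refl) x<x′ _ = x<x′
blockSwap-mono {h = h} (below x<a refl) (up a≤x′ _ refl) _ _ =
  ℕ.<-≤-trans x<a (ℕ.≤-trans a≤x′ (ℕ.m≤m+n _ h))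
blockSwap-mono {a} {h} {k} {y′ = y′} (below x<a refl) (down k≤x′ _ refl) _ _ =
  ℕ.<-≤-trans x<a (ℕ.+-cancelʳ-≤ k a y′ k≤x′)
blockSwap-mono (below _ refl) (above _ refl) x<x′ _ = x<x′
blockSwap-mono {a} {h} {k} (up a≤x _ _) (below x′<a _) x<x′ _ =
  contradiction (ℕ.<-trans x<x′ x′<a) (ℕ.≤⇒≯ a≤x)
blockSwap-mono {h = h} (up _ _ refl) (up _ _ refl) x<x′ _ = ℕ.+-monoˡ-< h x<x′
blockSwap-mono (up a≤x x<k _) (down k≤x′ x′<h _) _ ¬inv = contradiction (a≤x , x<k , k≤x′ , x′<h) ¬inv
blockSwap-mono {h = h} (up _ x<k refl) (above h≤x′ refl) _ _ = ℕ.<-≤-trans (ℕ.+-monoˡ-< h x<k) h≤x′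
blockSwap-mono {a} {h} {k} (down k≤x _ _) (below x′<a _) x<x′ _ =
  contradiction (ℕ.<-trans x<x′ x′<a) (ℕ.≤⇒≯ (ℕ.≤-trans (ℕ.m≤m+n a k) k≤x))
blockSwap-mono (down k≤x _ _) (up _ x′<k _) x<x′ _ = contradiction (ℕ.<-trans x<x′ x′<k) (ℕ.≤⇒≯ k≤x)
blockSwap-mono {k = k} {y = y} {y′} (down _ _ refl) (down _ _ refl) x<x′ _ = ℕ.+-cancelʳ-< k y y′ x<x′
blockSwap-mono {k = k} {y = y} (down _ _ refl) (above _ refl) x<x′ _ = ℕ.≤-<-trans (ℕ.m≤m+n y k) x<x′
blockSwap-mono {a} {h} {k} (above h≤x refl) (below x′<a _) x<x′ _ =
  contradiction (ℕ.<-trans x<x′ x′<a) (ℕ.≤⇒≯ (ℕ.≤-trans (ℕ.m≤m+n a k) (ℕ.≤-trans (ℕ.m≤m+n (a + k) h) h≤x)))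
blockSwap-mono {a} {h} {k} (above h≤x refl) (up _ x′<k _) x<x′ _ =
  contradiction (ℕ.<-trans x<x′ x′<k) (ℕ.≤⇒≯ (ℕ.≤-trans (ℕ.m≤m+n (a + k) h) h≤x))
blockSwap-mono (above h≤x refl) (down _ x′<h _) x<x′ _ = contradiction (ℕ.<-trans x<x′ x′<h) (ℕ.≤⇒≯ h≤x)
blockSwap-mono (above _ refl) (above _ refl) x<x′ _ = x<x′

-- The inverse relation is again a block swap and keeps or reverses strictly the order of any y <
-- y′, so it cannot send both to the same x.
blockSwap-functional : ∀ {a h k x y y′} → BlockSwap a h k x y → BlockSwap a h k x y′ → y ≡ y′
blockSwap-functional {y = y} {y′} p q with ℕ.<-cmp y y′
... | tri≈ _ y≡y′ _ = y≡y′
... | tri< y<y′ _ _ = contradiction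
  (blockSwap-mono (blockSwap-sym p) (blockSwap-sym q) y<y′
    (ℕ.<-irrefl refl ∘ blockSwap-inverted (blockSwap-sym p) (blockSwap-sym q)))
  (ℕ.<-irrefl refl)
... | tri> _ _ y′<y = contradiction
  (blockSwap-mono (blockSwap-sym q) (blockSwap-sym p) y′<y
    (ℕ.<-irrefl refl ∘ blockSwap-inverted (blockSwap-sym q) (blockSwap-sym p)))
  (ℕ.<-irrefl refl)

blockSwap-bounded : ∀ {a h k x y} → BlockSwap a h k x y → a + k + h ≤ n → x < n → y < n
blockSwap-bounded (below _ refl) c≤n x<n = x<n
blockSwap-bounded {h = h} (up _ x<k refl) c≤n _ = ℕ.<-≤-trans (ℕ.+-monoˡ-< h x<k) c≤n
blockSwap-bounded {k = k} {y = y} (down _ _ refl) _ x<n = ℕ.≤-<-trans (ℕ.m≤m+n y k) x<n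
blockSwap-bounded (above _ refl) _ x<n = x<n

IsBlockSwap : (a h k : ℕ) → Permutation′ n → Set
IsBlockSwap a h k ω = ∀ i → BlockSwap a h k (toℕ i) (toℕ (ω ⟨$⟩ʳ i))

module _ {a h k} {ω : Permutation′ n} (isω : IsBlockSwap a h k ω) where

  isBlockSwap-flip : IsBlockSwap a k h (flip ω)
  isBlockSwap-flip i = blockSwap-sym
    (subst (BlockSwap a h k (toℕ (ω ⟨$⟩ˡ i)) ∘ toℕ) (inverseʳ ω) (isω (ω ⟨$⟩ˡ i)))

  isBlockSwap-at : ∀ {x y} (x<n : x < n) → BlockSwap a h k x y → toℕ (ω ⟨$⟩ʳ fromℕ< x<n) ≡ y
  isBlockSwap-at x<n p = blockSwap-functional
    (subst (λ x → BlockSwap a h k x (toℕ (ω ⟨$⟩ʳ fromℕ< x<n))) (Fin.toℕ-fromℕ< x<n) (isω (fromℕ< x<n))) p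

  isBlockSwap-unique : ∀ {ρ : Permutation′ n} → IsBlockSwap a h k ρ → ω ≈ₚ ρ
  isBlockSwap-unique isρ i = Fin.toℕ-injective (blockSwap-functional (isω i) (isρ i))

blockSwap-exists : ∀ a h k → a + k + h ≤ n → ∃ λ ω → IsBlockSwap {n} a h k ω
blockSwap-exists {n} a h k c≤n = permutation (to h k c≤n) (to k h c≤n′)
  (inv h k c≤n c≤n′) (inv k h c≤n′ c≤n) , spec h k c≤n
  where
  c≤n′ : a + h + k ≤ n
  c≤n′ = subst (_≤ n) (+-swap a k h) c≤n
  to : ∀ h k → a + k + h ≤ n → Fin n → Fin n
  to h k c≤n i = fromℕ< (blockSwap-bounded (proj₂ (blockSwap-total a h k (toℕ i))) c≤n (Fin.toℕ<n i))
  spec : ∀ h k (c≤n : a + k + h ≤ n) i → BlockSwap a h k (toℕ i) (toℕ (to h k c≤n i))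
  spec h k c≤n i = subst (BlockSwap a h k (toℕ i)) (sym (Fin.toℕ-fromℕ< _)) (proj₂ (blockSwap-total a h k (toℕ i)))
  inv : ∀ h k (c≤n : a + k + h ≤ n) (c≤n′ : a + h + k ≤ n) i → to h k c≤n (to k h c≤n′ i) ≡ i
  inv h k c≤n c≤n′ i = Fin.toℕ-injective (blockSwap-functional
    (spec h k c≤n (to k h c≤n′ i)) (blockSwap-sym (spec k h c≤n′ i)))

-- Keeping the four lengths instead of the endpoints a < b < c turns the order into four
-- inequalities, tied together only by `sum≡n`. The length vector is (a + 1, h, k, l + 1).
record Block (ω : Permutation′ n) : Set where
  constructor mkBlock
  field
    a h k l     : ℕ
    0<h         : 0 < h
    0<k         : 0 < k
    sum≡n       : a + k + h + l ≡ n
    isBlockSwap : IsBlockSwap a h k ω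

  c≤n : a + k + h ≤ n
  c≤n = subst (a + k + h ≤_) sum≡n (ℕ.m≤m+n _ l)

block-flip : {ω : Permutation′ n} → Block ω → Block (flip ω)
block-flip {ω = ω} b = mkBlock a k h l 0<k 0<h (trans (cong (_+ l) (+-swap a h k)) sum≡n)
  (isBlockSwap-flip {ω = ω} isBlockSwap)
  where open Block b

-- Two neighbouring positions are inverted only if the boundary between the two moved blocks runs
-- between them. The pattern `suc k` makes `a + k` the last position of the first block.
block-oneDescent : {ω : Permutation′ n} → Block ω → OneDescent ω
block-oneDescent {n} {ω} (mkBlock a h (suc k) l 0<h _ sum≡n isω) =
  i , (j , j≡ , subst₂ _<_ (sym ωj) (sym ωi) a<a+k+h) , λ {i′} → unique {i′}
  where
  a+k<j = ℕ.n<1+n (a + k)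
  j<n : suc (a + k) < n
  j<n = ℕ.<-≤-trans (ℕ.m<m+n _ 0<h) (ℕ.≤-trans (ℕ.m≤m+n _ l)
    (ℕ.≤-reflexive (trans (cong (λ m → m + h + l) (sym (ℕ.+-suc a k))) sum≡n)))
  i<n = ℕ.<-trans a+k<j j<n
  i = fromℕ< i<n
  j = fromℕ< j<n
  j≡ : toℕ j ≡ suc (toℕ i)
  j≡ = trans (Fin.toℕ-fromℕ< j<n) (cong suc (sym (Fin.toℕ-fromℕ< i<n)))
  ωi : toℕ (ω ⟨$⟩ʳ i) ≡ a + k + h
  ωi = isBlockSwap-at {ω = ω} isω i<n (up (ℕ.m≤m+n a k) (ℕ.+-monoʳ-< a ℕ.≤-refl) refl)
  ωj : toℕ (ω ⟨$⟩ʳ j) ≡ a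
  ωj = isBlockSwap-at {ω = ω} isω j<n (down (ℕ.≤-reflexive (ℕ.+-suc a k))
    (subst (λ m → suc (a + k) < m + h) (sym (ℕ.+-suc a k)) (ℕ.m<m+n _ 0<h)) (sym (ℕ.+-suc a k)))
  a<a+k+h : a < a + k + h
  a<a+k+h = ℕ.≤-<-trans (ℕ.m≤m+n a k) (ℕ.m<m+n _ 0<h)
  unique : ∀ {i′} → Descent ω i′ → i ≡ i′
  unique {i′} (j′ , j′≡ , lt) with toℕ i′ ℕ.≟ a + k
  ... | yes eq = Fin.toℕ-injective (trans (Fin.toℕ-fromℕ< i<n) (sym eq))
  ... | no ¬eq = contradiction
    (blockSwap-mono (isω i′) (isω j′) (subst (toℕ i′ <_) (sym j′≡) ℕ.≤-refl) λ { (_ , i′< , k≤j′ , _) →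
      ¬eq (ℕ.≤-antisym (s≤s⁻¹ (subst (toℕ i′ <_) (ℕ.+-suc a k) i′<))
        (s≤s⁻¹ (subst₂ _≤_ (ℕ.+-suc a k) j′≡ k≤j′))) })
    (ℕ.<-asym lt)

block-bigrassmannian : {ω : Permutation′ n} → Block ω → Bigrassmannian ω
block-bigrassmannian {ω = ω} b = block-oneDescent b , block-oneDescent (block-flip {ω = ω} b)

-- The Bruhat order on block swaps

-- The properties of a block swap that still make sense, and persist, once reductions have left the
-- block swaps. For a block swap itself `c` is `a + k + h`.
record Confined (a h k c : ℕ) (ω : Permutation′ n) : Set where
  field
    fixed-below : ∀ i → toℕ i < a → ω ⟨$⟩ʳ i ≡ i
    fixed-above : ∀ i → c ≤ toℕ i → ω ⟨$⟩ʳ i ≡ i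
    rise        : ∀ i → toℕ (ω ⟨$⟩ʳ i) ≤ toℕ i + h
    fall        : ∀ i → toℕ i ≤ toℕ (ω ⟨$⟩ʳ i) + k

confined-resp : ∀ {a h k c} {π σ : Permutation′ n} → π ≈ₚ σ → Confined a h k c σ → Confined a h k c π
confined-resp {h = h} {k} π≈σ σ-conf = record
  { fixed-below = λ i i<a → trans (π≈σ i) (fixed-below i i<a)
  ; fixed-above = λ i c≤i → trans (π≈σ i) (fixed-above i c≤i)
  ; rise        = λ i → subst (λ x → toℕ x ≤ toℕ i + h) (sym (π≈σ i)) (rise i)
  ; fall        = λ i → subst (λ x → toℕ i ≤ toℕ x + k) (sym (π≈σ i)) (fall i)
  }
  where open Confined σ-conf

-- A reduction reaching into the fixed prefix or suffix would exchange two fixed points, which are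
-- not inverted. For `rise`, position i receives a smaller entry than before, and position j
-- receives an entry that already obeyed the stricter bound at i; `fall` is dual.
confined-↘ : ∀ {a h k c} {σ ρ : Permutation′ n} → σ ↘ ρ → Confined a h k c σ → Confined a h k c ρ
confined-↘ {n} {a} {h} {k} {c} {σ} {ρ} (i , j , i<j , σj<σi , ρ≈) σ-conf =
  confined-resp {π = ρ} {transpose i j ∘ₚ σ} ρ≈ (record
    { fixed-below = λ m → below′ (transposed i j m)
    ; fixed-above = λ m → above′ (transposed i j m)
    ; rise        = λ m → rise′ (transposed i j m)
    ; fall        = λ m → fall′ (transposed i j m)
    })
  where
  open Confined σ-conf
  inversion-not-fixed : ¬ (σ ⟨$⟩ʳ i ≡ i × σ ⟨$⟩ʳ j ≡ j)
  inversion-not-fixed (σi≡i , σj≡j) = ℕ.<-asym i<j (subst₂ Fin._<_ σj≡j σi≡i σj<σi)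
  below′ : ∀ {m m′} → Transposed i j m m′ → toℕ m < a → σ ⟨$⟩ʳ m′ ≡ m
  below′ left i<a = contradiction (σi≡i , ⟨$⟩ʳ-injective σ (fixed-below _ σj<a)) inversion-not-fixed
    where
    σi≡i = fixed-below i i<a
    σj<a = ℕ.<-trans (subst (σ ⟨$⟩ʳ j Fin.<_) σi≡i σj<σi) i<a
  below′ right j<a = contradiction (fixed-below i (ℕ.<-trans i<j j<a) , fixed-below j j<a) inversion-not-fixed
  below′ (other _ _) m<a = fixed-below _ m<a
  above′ : ∀ {m m′} → Transposed i j m m′ → c ≤ toℕ m → σ ⟨$⟩ʳ m′ ≡ m
  above′ left c≤i = contradiction (fixed-above i c≤i , fixed-above j (ℕ.≤-trans c≤i (ℕ.<⇒≤ i<j))) inversion-not-fixed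
  above′ right c≤j = contradiction (⟨$⟩ʳ-injective σ (fixed-above _ c≤σi) , σj≡j) inversion-not-fixed
    where
    σj≡j = fixed-above j c≤j
    c≤σi = ℕ.≤-trans c≤j (ℕ.<⇒≤ (subst (Fin._< σ ⟨$⟩ʳ i) σj≡j σj<σi))
  above′ (other _ _) c≤m = fixed-above _ c≤m
  rise′ : ∀ {m m′} → Transposed i j m m′ → toℕ (σ ⟨$⟩ʳ m′) ≤ toℕ m + h
  rise′ left        = ℕ.≤-trans (ℕ.<⇒≤ σj<σi) (rise i)
  rise′ right       = ℕ.≤-trans (rise i) (ℕ.+-monoˡ-≤ h (ℕ.<⇒≤ i<j))
  rise′ (other _ _) = rise _
  fall′ : ∀ {m m′} → Transposed i j m m′ → toℕ m ≤ toℕ (σ ⟨$⟩ʳ m′) + k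
  fall′ left        = ℕ.≤-trans (ℕ.<⇒≤ i<j) (fall j)
  fall′ right       = ℕ.≤-trans (fall j) (ℕ.+-monoˡ-≤ k (ℕ.<⇒≤ σj<σi))
  fall′ (other _ _) = fall _

confined-≤ᴮ : ∀ {a h k c} {π σ : Permutation′ n} → π ≤ᴮ σ → Confined a h k c σ → Confined a h k c π
confined-≤ᴮ {π = π} (done {σ} π≈σ) = confined-resp {π = π} {σ} π≈σ
confined-≤ᴮ (reduce {σ} {ρ} s p) = confined-≤ᴮ p ∘ confined-↘ {σ = σ} {ρ} s

isBlockSwap-confined : ∀ {a h k} {ω : Permutation′ n} → IsBlockSwap a h k ω → Confined a h k (a + k + h) ω
isBlockSwap-confined {n} {a} {h} {k} {ω} isω = record
  { fixed-below = λ i i<a → Fin.toℕ-injective (blockSwap-functional (isω i) (below i<a refl))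
  ; fixed-above = λ i c≤i → Fin.toℕ-injective (blockSwap-functional (isω i) (above c≤i refl))
  ; rise        = λ i → rise (isω i)
  ; fall        = λ i → rise (blockSwap-sym (isω i))
  }
  where
  rise : ∀ {a h k x y} → BlockSwap a h k x y → y ≤ x + h
  rise {h = h} (below _ refl) = ℕ.m≤m+n _ h
  rise (up _ _ refl) = ℕ.≤-refl
  rise {h = h} {k} {y = y} (down _ _ refl) = ℕ.≤-trans (ℕ.m≤m+n y k) (ℕ.m≤m+n _ h)
  rise {h = h} (above _ refl) = ℕ.m≤m+n _ h

record _≼_ {π σ : Permutation′ n} (bπ : Block π) (bσ : Block σ) : Set where
  private
    module π = Block bπ
    module σ = Block bσ
  field
    a≥ : σ.a ≤ π.a
    h≤ : π.h ≤ σ.h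
    k≤ : π.k ≤ σ.k
    l≥ : σ.l ≤ π.l

+-≡-≤ : ∀ {m n m′ n′} → m + n ≡ m′ + n′ → m ≤ m′ → n′ ≤ n
+-≡-≤ {m} {n} {m′} {n′} eq m≤m′ = ℕ.+-cancelˡ-≤ m n′ n (ℕ.≤-trans (ℕ.+-monoˡ-≤ n′ m≤m′) (ℕ.≤-reflexive (sym eq)))

-- The bounds of σ hold for π and are tested where π attains its own: position `a` is moved and
-- rises by `h`, position `a + k` falls by `k`, and `a + k + h′` is the last position moved.
≤ᴮ⇒≼ : {π σ : Permutation′ n} (bπ : Block π) (bσ : Block σ) → π ≤ᴮ σ → bπ ≼ bσ
≤ᴮ⇒≼ {n} {π} {σ} bπ@(mkBlock a h@(suc h′) k l 0<h 0<k sum≡n isπ) bσ π≤σ = record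
  { a≥ = ℕ.≮⇒≥ λ a<a′ → ℕ.m+1+n≢m a
      (trans (sym πa) (trans (cong toℕ (fixed-below _
        (subst (_< σ.a) (sym (Fin.toℕ-fromℕ< a<n)) a<a′))) (Fin.toℕ-fromℕ< a<n)))
  ; h≤ = ℕ.+-cancelˡ-≤ a h σ.h (subst₂ _≤_ πa (cong (_+ σ.h) (Fin.toℕ-fromℕ< a<n)) (rise _))
  ; k≤ = ℕ.+-cancelˡ-≤ a k σ.k (subst₂ _≤_ (Fin.toℕ-fromℕ< a+k<n) (cong (_+ σ.k) πa+k) (fall _))
  ; l≥ = +-≡-≤ (trans sum≡n (sym σ.sum≡n)) (ℕ.≮⇒≥ λ c′<c → ℕ.<-irrefl
      (trans (sym πlast) (trans (cong toℕ (fixed-above _ (subst (σ.a + σ.k + σ.h ≤_) (sym (Fin.toℕ-fromℕ< last<n))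
        (s≤s⁻¹ (subst (σ.a + σ.k + σ.h <_) (ℕ.+-suc (a + k) h′) c′<c)))))
        (trans (Fin.toℕ-fromℕ< last<n) (+-swap a k h′))))
      (ℕ.m<m+n (a + h′) 0<k))
  }
  where
  module σ = Block bσ
  open Confined (confined-≤ᴮ π≤σ (isBlockSwap-confined {ω = σ} σ.isBlockSwap))
  c≤n = Block.c≤n bπ
  a+k<n : a + k < n
  a+k<n = ℕ.<-≤-trans (ℕ.m<m+n _ 0<h) c≤n
  a<n : a < n
  a<n = ℕ.≤-<-trans (ℕ.m≤m+n a k) a+k<n
  last<n : a + k + h′ < n
  last<n = ℕ.<-≤-trans (ℕ.+-monoʳ-< (a + k) (ℕ.n<1+n h′)) c≤n
  πa = isBlockSwap-at {ω = π} isπ a<n (up ℕ.≤-refl (ℕ.m<m+n a 0<k) refl)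
  πa+k = isBlockSwap-at {ω = π} isπ a+k<n (down ℕ.≤-refl (ℕ.m<m+n _ 0<h) refl)
  πlast = isBlockSwap-at {ω = π} isπ last<n (down (ℕ.m≤m+n _ h′) (ℕ.+-monoʳ-< (a + k) (ℕ.n<1+n h′)) (+-swap a k h′))

-- By values, the inversions are the pairs u < v with u in [a, b) and v in [b, c), where b = a + h
-- and c = b + k. With b in common, widening both intervals enlarges the inversion set.
isBlockSwap-≤ᴮ : ∀ {a h k a′ h′ k′} {π σ : Permutation′ n} →
                 IsBlockSwap a h k π → IsBlockSwap a′ h′ k′ σ →
                 a + h ≡ a′ + h′ → a′ ≤ a → k ≤ k′ → π ≤ᴮ σ
isBlockSwap-≤ᴮ {a = a} {h} {k} {a′} {h′} {k′} {π} {σ} isπ isσ b≡b′ a′≤a k≤k′ =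
  ≤ᵂ⇒≤ᴮ {π = π} {σ} λ u v u<v πv<πu → ¬¬-< λ ¬σ →
    ℕ.<-asym πv<πu (blockSwap-mono (isBlockSwap-flip {ω = π} isπ u) (isBlockSwap-flip {ω = π} isπ v) u<v
      λ { (a≤u , u<b , b≤v , v<c) → ¬σ (blockSwap-inverted
        (isBlockSwap-flip {ω = σ} isσ u) (isBlockSwap-flip {ω = σ} isσ v)
        ( ℕ.≤-trans a′≤a a≤u
        , subst (toℕ u <_) b≡b′ u<b
        , subst (_≤ toℕ v) b≡b′ b≤v
        , ℕ.<-≤-trans v<c (subst (λ m → a + h + k ≤ m + k′) b≡b′ (ℕ.+-monoʳ-≤ (a + h) k≤k′)))) })
  where
  ¬¬-< : ∀ {x y} → ¬ ¬ (x < y) → x < y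
  ¬¬-< ¬¬x<y = ℕ.≰⇒> λ y≤x → ¬¬x<y (ℕ.≤⇒≯ y≤x)

isBlockSwap-≤ᴮ′ : ∀ {a h k a′ h′ k′} {π σ : Permutation′ n} →
                 IsBlockSwap a h k π → IsBlockSwap a′ h′ k′ σ →
                 a + k ≡ a′ + k′ → a′ ≤ a → h ≤ h′ → π ≤ᴮ σ
isBlockSwap-≤ᴮ′ {π = π} {σ} isπ isσ p≡p′ a′≤a h≤h′ = ≤ᴮ-flip⁻ {π = π} {σ}
  (isBlockSwap-≤ᴮ {π = flip π} {flip σ} (isBlockSwap-flip {ω = π} isπ) (isBlockSwap-flip {ω = σ} isσ) p≡p′ a′≤a h≤h′)

-- A block swap τ between π and σ sharing b = a + h with σ and p = a + k with π.
≼⇒≤ᴮ : {π σ : Permutation′ n} (bπ : Block π) (bσ : Block σ) → bπ ≼ bσ → π ≤ᴮ σ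
≼⇒≤ᴮ {n} {π} {σ} bπ bσ bπ≼bσ = compare (ℕ.≤-total (π.a + π.h) (σ.a + σ.h))
  where
  module π = Block bπ
  module σ = Block bσ
  open _≼_ bπ≼bσ
  via : ∀ a h k → a + k + h ≤ n → a + h ≡ σ.a + σ.h → σ.a ≤ a → k ≤ σ.k →
        π.a + π.k ≡ a + k → a ≤ π.a → π.h ≤ h → π ≤ᴮ σ
  via a h k c≤n b≡ σa≤a k≤σk p≡ a≤πa πh≤h = let τ , isτ = blockSwap-exists a h k c≤n in ≤ᴮ-trans
    (isBlockSwap-≤ᴮ′ {π = π} {τ} π.isBlockSwap isτ p≡ a≤πa πh≤h)
    (isBlockSwap-≤ᴮ {π = τ} {σ} isτ σ.isBlockSwap b≡ σa≤a k≤σk)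

  πc≤σc : π.a + π.k + π.h ≤ σ.a + σ.k + σ.h
  πc≤σc = +-≡-≤ (trans (ℕ.+-comm σ.l _) (trans (trans σ.sum≡n (sym π.sum≡n)) (ℕ.+-comm _ π.l))) l≥

  compare : π.a + π.h ≤ σ.a + σ.h ⊎ σ.a + σ.h ≤ π.a + π.h → π ≤ᴮ σ
  compare (inj₁ πb≤σb) with h , πa+h≡σb ← ℕ.m≤n⇒∃[o]m+o≡n (ℕ.m+n≤o⇒m≤o π.a πb≤σb) =
    via π.a h π.k c≤n πa+h≡σb a≥ k≤ refl ℕ.≤-refl
      (ℕ.+-cancelˡ-≤ π.a π.h h (subst (π.a + π.h ≤_) (sym πa+h≡σb) πb≤σb))
    where
    open ℕ.≤-Reasoning
    c≤n : π.a + π.k + h ≤ n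
    c≤n = begin
      π.a + π.k + h   ≡⟨ +-swap π.a π.k h ⟩
      π.a + h + π.k   ≡⟨ cong (_+ π.k) πa+h≡σb ⟩
      σ.a + σ.h + π.k ≤⟨ ℕ.+-monoʳ-≤ (σ.a + σ.h) k≤ ⟩
      σ.a + σ.h + σ.k ≡⟨ +-swap σ.a σ.h σ.k ⟩
      σ.a + σ.k + σ.h ≤⟨ σ.c≤n ⟩
      n               ∎
  -- Here `h` cannot be raised to reach the b of σ, so it stays that of π; `a` is lowered instead,
  -- and `k` grows to keep `a + k`. Then `k ≤ σ.k` because b is shared with σ and the c of π, kept
  -- by τ, is at most that of σ, which comes from `l≥`.
  compare (inj₂ σb≤πb) = via a π.h k (subst (_≤ n) (cong (_+ π.h) (sym a+k≡p)) π.c≤n) a+h≡σb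
    (ℕ.+-cancelʳ-≤ π.h σ.a a (subst (σ.a + π.h ≤_) (sym a+h≡σb) (ℕ.+-monoʳ-≤ σ.a h≤)))
    (ℕ.+-cancelˡ-≤ (a + π.h) k σ.k (begin
      a + π.h + k     ≡⟨ +-swap a π.h k ⟩
      a + k + π.h     ≡⟨ cong (_+ π.h) a+k≡p ⟩
      π.a + π.k + π.h ≤⟨ πc≤σc ⟩
      σ.a + σ.k + σ.h ≡⟨ +-swap σ.a σ.k σ.h ⟩
      σ.a + σ.h + σ.k ≡⟨ cong (_+ σ.k) a+h≡σb ⟨
      a + π.h + σ.k   ∎))
    (sym a+k≡p) a≤πa ℕ.≤-refl
    where
    open ℕ.≤-Reasoning
    a = σ.a + σ.h ∸ π.h
    a+h≡σb : a + π.h ≡ σ.a + σ.h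
    a+h≡σb = ℕ.m∸n+n≡m (ℕ.≤-trans h≤ (ℕ.m≤n+m σ.h σ.a))
    a≤πa : a ≤ π.a
    a≤πa = ℕ.+-cancelʳ-≤ π.h a π.a (subst (_≤ π.a + π.h) (sym a+h≡σb) σb≤πb)
    k = π.a + π.k ∸ a
    a+k≡p : a + k ≡ π.a + π.k
    a+k≡p = ℕ.m+[n∸m]≡n (ℕ.≤-trans a≤πa (ℕ.m≤m+n π.a π.k))

-- Bigrassmannian permutations are block swaps

ascending : {ω : Permutation′ n} {d : Fin n} → (∀ {i} → Descent ω i → d ≡ i) →
            ∀ {x y} → x Fin.< y → ¬ (x Fin.≤ d × d Fin.< y) → ω ⟨$⟩ʳ x Fin.< ω ⟨$⟩ʳ y
ascending {n} {ω} {d} d-unique {x} x<y = let k , eq = ℕ.m≤n⇒∃[o]m+o≡n x<y in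
  go k (trans (sym eq) (cong suc (ℕ.+-comm (toℕ x) k)))
  where
  step : ∀ {x y} → toℕ y ≡ suc (toℕ x) → x ≢ d → ω ⟨$⟩ʳ x Fin.< ω ⟨$⟩ʳ y
  step {x} {y} y≡ x≢d with Fin.<-cmp (ω ⟨$⟩ʳ x) (ω ⟨$⟩ʳ y)
  ... | tri< lt _ _ = lt
  ... | tri≈ _ eq _ = contradiction (trans (sym y≡) (cong toℕ (sym (⟨$⟩ʳ-injective ω eq)))) ℕ.1+n≢n
  ... | tri> _ _ gt = contradiction (sym (d-unique (y , y≡ , gt))) x≢d
  go : ∀ k {y} → toℕ y ≡ suc (k + toℕ x) → ¬ (x Fin.≤ d × d Fin.< y) → ω ⟨$⟩ʳ x Fin.< ω ⟨$⟩ʳ y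
  go zero y≡ ¬d = step y≡ λ { refl → ¬d (ℕ.≤-refl , ℕ.≤-reflexive (sym y≡)) }
  go (suc k) {y} y≡ ¬d = ℕ.<-trans
    (go k (Fin.toℕ-fromℕ< y′<n) λ (x≤d , d<y′) → ¬d (x≤d , ℕ.<-trans d<y′ y′<y))
    (step (trans y≡ (cong suc (sym (Fin.toℕ-fromℕ< y′<n)))) λ { y′≡d → ¬d
      ( subst (toℕ x ≤_) (cong toℕ y′≡d) (subst (toℕ x ≤_) (sym (Fin.toℕ-fromℕ< y′<n)) (ℕ.m≤n+m (toℕ x) (suc k)))
      , subst (Fin._< y) y′≡d y′<y) })
    where
    y′<n : suc (k + toℕ x) < n
    y′<n = ℕ.<-trans (ℕ.≤-reflexive (sym y≡)) (Fin.toℕ<n y)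
    y′ = fromℕ< y′<n
    y′<y : y′ Fin.< y
    y′<y = ℕ.≤-reflexive (trans (cong suc (Fin.toℕ-fromℕ< y′<n)) (sym y≡))

-- With π the block swap given by b = e + 1 and the values c - 1 and a of ω on both
-- sides of its descent, π⁻¹ω is increasing.
classify : {ω : Permutation′ n} → Bigrassmannian ω → Block ω
classify {n} {ω} ((d , (d′ , d′≡ , ωd′<ωd) , d-unique) , (e , _ , e-unique)) =
  mkBlock a h k l 0<h 0<k sum≡n λ i →
    subst (λ v → BlockSwap a h k (toℕ i) (toℕ v))
      (trans (cong (π ⟨$⟩ʳ_) (sym (increasing⇒id inc i))) (inverseʳ π)) (isπ i)
  where
  a = toℕ (ω ⟨$⟩ʳ d′)
  d<d′ : d Fin.< d′
  d<d′ = ℕ.≤-reflexive (sym d′≡)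
  ascʳ : ∀ {x y} → x Fin.< y → ¬ (x Fin.≤ d × d Fin.< y) → ω ⟨$⟩ʳ x Fin.< ω ⟨$⟩ʳ y
  ascʳ = ascending {ω = ω} d-unique
  ascˡ : ∀ {x y} → ω ⟨$⟩ʳ x Fin.< ω ⟨$⟩ʳ y → ¬ (ω ⟨$⟩ʳ x Fin.≤ e × e Fin.< ω ⟨$⟩ʳ y) → x Fin.< y
  ascˡ lt ¬e = subst₂ Fin._<_ (inverseˡ ω) (inverseˡ ω) (ascending {ω = flip ω} e-unique lt ¬e)

  -- The values ω d′ < ω d occur in reversed order, so the only descent `e` of the inverse must
  -- separate them.
  a≤e×e<ωd : ω ⟨$⟩ʳ d′ Fin.≤ e × e Fin.< ω ⟨$⟩ʳ d
  a≤e×e<ωd = decidable-stable ((a ℕ.≤? toℕ e) ×-dec (e Fin.<? ω ⟨$⟩ʳ d)) λ ¬e → ℕ.<-asym d<d′ (ascˡ ωd′<ωd ¬e)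
  a≤e = proj₁ a≤e×e<ωd
  e<ωd = proj₂ a≤e×e<ωd

  h = suc (toℕ e) ∸ a
  a+h≡ : a + h ≡ suc (toℕ e)
  a+h≡ = ℕ.m+[n∸m]≡n (ℕ.m≤n⇒m≤1+n a≤e)
  0<h = ℕ.m<n⇒0<n∸m (s≤s a≤e)
  k = toℕ (ω ⟨$⟩ʳ d) ∸ toℕ e
  0<k = ℕ.m<n⇒0<n∸m e<ωd
  a+h+k≡ : a + h + k ≡ suc (toℕ (ω ⟨$⟩ʳ d))
  a+h+k≡ = trans (cong (_+ k) a+h≡) (cong suc (ℕ.m+[n∸m]≡n (ℕ.<⇒≤ e<ωd)))
  l = n ∸ suc (toℕ (ω ⟨$⟩ʳ d))
  sum≡n : a + k + h + l ≡ n
  sum≡n = trans (cong (_+ l) (trans (+-swap a k h) a+h+k≡)) (ℕ.m+[n∸m]≡n (Fin.toℕ<n (ω ⟨$⟩ʳ d)))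
  block = blockSwap-exists a h k (subst (a + k + h ≤_) sum≡n (ℕ.m≤m+n _ l))
  π = proj₁ block
  isπ = proj₂ block
  isπ⁻¹ = isBlockSwap-flip {ω = π} isπ

  -- Values on one side of `e` occur from left to right. As the value `a` sits at d′, no value in
  -- [a, b) occurs left of d; as c - 1 sits at d, no value in [b, c) occurs right of d.
  ¬inverted : ∀ {i j} → toℕ j ≡ suc (toℕ i) → i ≢ d → ¬ Inverted a k h (toℕ (ω ⟨$⟩ʳ i)) (toℕ (ω ⟨$⟩ʳ j))
  ¬inverted {i} {j} j≡ i≢d (a≤ωi , ωi<b , b≤ωj , ωj<c) with Fin.<-cmp i d
  ... | tri≈ _ i≡d _ = i≢d i≡d
  ... | tri< i<d _ _ = ℕ.<-asym (ℕ.<-trans i<d d<d′)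
    (ascˡ (ℕ.≤∧≢⇒< a≤ωi λ eq → ℕ.<-irrefl (cong toℕ (sym (⟨$⟩ʳ-injective ω (Fin.toℕ-injective eq))))
        (ℕ.<-trans i<d d<d′))
      λ (_ , e<ωi) → ℕ.<⇒≱ (subst (toℕ (ω ⟨$⟩ʳ i) <_) a+h≡ ωi<b) e<ωi)
  ... | tri> _ _ d<i = ℕ.<-asym d<j
    (ascˡ (ℕ.≤∧≢⇒< (s≤s⁻¹ (subst (toℕ (ω ⟨$⟩ʳ j) <_) a+h+k≡ ωj<c)) λ eq →
        ℕ.<-irrefl (cong toℕ (sym (⟨$⟩ʳ-injective ω (Fin.toℕ-injective eq)))) d<j)
      λ (ωj≤e , _) → ℕ.<⇒≱ (subst (_≤ toℕ (ω ⟨$⟩ʳ j)) a+h≡ b≤ωj) ωj≤e)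
    where
    d<j : d Fin.< j
    d<j = ℕ.<-trans d<i (ℕ.≤-reflexive (sym j≡))

  inc : Increasing (λ i → π ⟨$⟩ˡ (ω ⟨$⟩ʳ i))
  inc i j j≡ with i Fin.≟ d
  ... | no i≢d = blockSwap-mono (isπ⁻¹ (ω ⟨$⟩ʳ i)) (isπ⁻¹ (ω ⟨$⟩ʳ j))
    (ascʳ (ℕ.≤-reflexive (sym j≡)) λ (i≤d , d<j) →
      i≢d (Fin.toℕ-injective (ℕ.≤-antisym i≤d (s≤s⁻¹ (subst (toℕ d <_) j≡ d<j)))))
    (¬inverted j≡ i≢d)
  ... | yes refl with refl ← Fin.toℕ-injective {i = j} {d′} (trans j≡ (sym d′≡)) =
    blockSwap-inverted (isπ⁻¹ (ω ⟨$⟩ʳ j)) (isπ⁻¹ (ω ⟨$⟩ʳ i))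
      ( ℕ.≤-refl
      , ℕ.m<m+n a 0<h
      , subst (_≤ toℕ (ω ⟨$⟩ʳ d)) (sym a+h≡) e<ωd
      , subst (toℕ (ω ⟨$⟩ʳ d) <_) (sym a+h+k≡) ℕ.≤-refl)

-- Length vectors

tabulate-injective : {f g : Fin n → A} → List.tabulate f ≡ List.tabulate g → f ≗ g
tabulate-injective {suc n} eq Fin.zero    = List.∷-injectiveˡ eq
tabulate-injective {suc n} eq (Fin.suc i) = tabulate-injective (List.∷-injectiveʳ eq) i

tabulate-applyUpTo : {f : Fin n → A} {g : ℕ → A} → (∀ i → f i ≡ g (toℕ i)) → List.tabulate f ≡ applyUpTo g n
tabulate-applyUpTo {zero}  eq = refl
tabulate-applyUpTo {suc n} eq = cong₂ _∷_ (eq Fin.zero) (tabulate-applyUpTo (eq ∘ Fin.suc))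

applyUpTo-++ : (f : ℕ → A) → ∀ m n → applyUpTo f (m + n) ≡ applyUpTo f m ++ applyUpTo (f ∘ _+_ m) n
applyUpTo-++ f zero    n = refl
applyUpTo-++ f (suc m) n = cong (f 0 ∷_) (applyUpTo-++ (f ∘ suc) m n)

applyUpTo-cong : {f g : ℕ → A} → ∀ n → (∀ {i} → i < n → f i ≡ g i) → applyUpTo f n ≡ applyUpTo g n
applyUpTo-cong zero    eq = refl
applyUpTo-cong (suc n) eq = cong₂ _∷_ (eq z<s) (applyUpTo-cong n (eq ∘ s<s))

oneLine-blockSwap : ∀ a h k l → a + k + h + l ≡ n → {ω : Permutation′ n} → IsBlockSwap a h k ω →
  oneLine ω ≡ ⟨ 0 ⋯ a ] ++ ⟨ a + h ⋯ a + h + k ] ++ ⟨ a ⋯ a + h ] ++ ⟨ a + h + k ⋯ n ]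
oneLine-blockSwap a h k l refl {ω} isω = begin
  oneLine ω
    ≡⟨ tabulate-applyUpTo (λ i → cong suc (blockSwap-functional (isω i) (proj₂ (total (toℕ i))))) ⟩
  applyUpTo F (a + k + h + l)
    ≡⟨ applyUpTo-++ F (a + k + h) l ⟩
  applyUpTo F (a + k + h) ++ F₄
    ≡⟨ cong (_++ F₄) (applyUpTo-++ F (a + k) h) ⟩
  (applyUpTo F (a + k) ++ F₃) ++ F₄
    ≡⟨ cong (λ xs → (xs ++ F₃) ++ F₄) (applyUpTo-++ F a k) ⟩
  ((applyUpTo F a ++ F₂) ++ F₃) ++ F₄
    ≡⟨ List.++-assoc (applyUpTo F a ++ F₂) F₃ F₄ ⟩
  (applyUpTo F a ++ F₂) ++ F₃ ++ F₄
    ≡⟨ List.++-assoc (applyUpTo F a) F₂ (F₃ ++ F₄) ⟩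
  applyUpTo F a ++ F₂ ++ F₃ ++ F₄
    ≡⟨ cong₂ _++_ (applyUpTo-cong a λ i<a → F≡ (below i<a refl))
        (cong₂ _++_ (segment (a + h) k λ {i} i<k → F≡ (up (ℕ.m≤m+n a i) (ℕ.+-monoʳ-< a i<k) (+-swap a h i)))
          (cong₂ _++_ (segment a h λ {i} i<h → F≡ (down (ℕ.m≤m+n (a + k) i) (ℕ.+-monoʳ-< (a + k) i<h) (+-swap a k i)))
            (segment′ λ {i} i<l → F≡ (above (ℕ.m≤m+n (a + k + h) i) (cong (_+ i) (+-swap a h k)))))) ⟩
  ⟨ 0 ⋯ a ] ++ ⟨ a + h ⋯ a + h + k ] ++ ⟨ a ⋯ a + h ] ++ ⟨ a + h + k ⋯ a + k + h + l ] ∎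
  where
  open ≡-Reasoning
  total = blockSwap-total a h k
  F : ℕ → ℕ
  F x = suc (proj₁ (total x))
  F₂ = applyUpTo (F ∘ _+_ a) k
  F₃ = applyUpTo (F ∘ _+_ (a + k)) h
  F₄ = applyUpTo (F ∘ _+_ (a + k + h)) l
  F≡ : ∀ {x y} → BlockSwap a h k x y → F x ≡ suc y
  F≡ p = cong suc (blockSwap-functional (proj₂ (total _)) p)
  segment : ∀ {f : ℕ → ℕ} b m → (∀ {i} → i < m → f i ≡ suc (b + i)) → applyUpTo f m ≡ ⟨ b ⋯ b + m ]
  segment b m eq = trans (applyUpTo-cong m eq) (cong (applyUpTo _) (sym (ℕ.m+n∸m≡n b m)))
  segment′ : ∀ {f : ℕ → ℕ} → (∀ {i} → i < l → f i ≡ suc (a + h + k + i)) →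
             applyUpTo f l ≡ ⟨ a + h + k ⋯ a + k + h + l ]
  segment′ eq = trans (segment (a + h + k) l eq) (cong (λ m → ⟨ a + h + k ⋯ m + l ]) (+-swap a h k))

-- The word determines the permutation, so ω takes over the block structure of the explicit block
-- swap ρ with the same word.
lengthVector⇒block : ∀ {ω : Permutation′ n} {ℓ₁ ℓ₂ ℓ₃ ℓ₄} → HasLengthVector ω ℓ₁ ℓ₂ ℓ₃ ℓ₄ →
  Σ (Block ω) λ b → let open Block b in ℓ₁ ≡ a + 1 × ℓ₂ ≡ h × ℓ₃ ≡ k × ℓ₄ ≡ l + 1
lengthVector⇒block {n} {ω} (a , b , c , a<b , b<c , c≤n , line , refl , refl , refl , refl)
  with h , refl ← ℕ.m≤n⇒∃[o]m+o≡n (ℕ.<⇒≤ a<b)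
  with k , refl ← ℕ.m≤n⇒∃[o]m+o≡n (ℕ.<⇒≤ b<c)
  with l , sum≡n ← ℕ.m≤n⇒∃[o]m+o≡n c≤n =
  mkBlock a h k l (ℕ.+-cancelˡ-< a 0 h (subst (_< a + h) (sym (ℕ.+-identityʳ a)) a<b))
    (ℕ.+-cancelˡ-< (a + h) 0 k (subst (_< a + h + k) (sym (ℕ.+-identityʳ (a + h))) b<c)) sum≡n′
    (λ i → subst (λ x → BlockSwap a h k (toℕ i) x)
      (ℕ.suc-injective (tabulate-injective (trans (oneLine-blockSwap a h k l sum≡n′ {ρ} isρ) (sym line)) i)) (isρ i))
  , refl , ℕ.m+n∸m≡n a h , ℕ.m+n∸m≡n (a + h) k
  , trans (cong (λ m → m + 1 ∸ (a + h + k)) (sym sum≡n))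
      (trans (cong (_∸ (a + h + k)) (ℕ.+-assoc (a + h + k) l 1)) (ℕ.m+n∸m≡n (a + h + k) (l + 1)))
  where
  sum≡n′ : a + k + h + l ≡ n
  sum≡n′ = trans (cong (_+ l) (+-swap a k h)) sum≡n
  block = blockSwap-exists {n} a h k (subst (_≤ n) (+-swap a h k) c≤n)
  ρ = proj₁ block
  isρ = proj₂ block

-- The Möbius function of the balanced vectors

∑ : {A : Set} → (A → ℤ) → List A → ℤ
∑ f xs = sumℤ (List.map f xs)

module _ {A : Set} where

  ∑-cong : {f g : A → ℤ} → (∀ x → f x ≡ g x) → ∀ xs → ∑ f xs ≡ ∑ g xs
  ∑-cong f≡g []       = refl
  ∑-cong f≡g (x ∷ xs) = cong₂ _+ᶻ_ (f≡g x) (∑-cong f≡g xs)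

  ∑-+ : ∀ (f g : A → ℤ) xs → ∑ (λ x → f x +ᶻ g x) xs ≡ ∑ f xs +ᶻ ∑ g xs
  ∑-+ f g []       = refl
  ∑-+ f g (x ∷ xs) = trans (cong ((f x +ᶻ g x) +ᶻ_) (∑-+ f g xs))
    (interchange ℤ.+-commutativeSemigroup (f x) (g x) _ _)

  ∑-0 : ∀ (xs : List A) → ∑ (λ _ → 0ℤ) xs ≡ 0ℤ
  ∑-0 []       = refl
  ∑-0 (x ∷ xs) = trans (ℤ.+-identityˡ _) (∑-0 xs)

∑-swap : {A B : Set} (f : A → B → ℤ) → ∀ xs ys → ∑ (λ x → ∑ (f x) ys) xs ≡ ∑ (λ y → ∑ (λ x → f x y) xs) ys
∑-swap f []       ys = sym (∑-0 ys)
∑-swap f (x ∷ xs) ys = trans (cong (∑ (f x) ys +ᶻ_) (∑-swap f xs ys)) (sym (∑-+ (f x) _ ys))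

infix 8 [_]_

[_]_ : {P : Set} → Dec P → ℤ → ℤ
[ P? ] c = if does P? then c else 0ℤ

[]-⇔ : {P Q : Set} {c : ℤ} (P? : Dec P) (Q? : Dec Q) → (P → Q) → (Q → P) → [ P? ] c ≡ [ Q? ] c
[]-⇔ (yes p) (yes q) _   _   = refl
[]-⇔ (no ¬p) (no ¬q) _   _   = refl
[]-⇔ (yes p) (no ¬q) P→Q _   = contradiction (P→Q p) ¬q
[]-⇔ (no ¬p) (yes q) _   Q→P = contradiction (Q→P q) ¬p

V : Set
V = ℕ × ℕ × ℕ × ℕ

-- The entries of an offset say how much `a` drops, `h` and `k` grow, and `l` drops. Since the four
-- lengths always add up to n, drops and growths agree.
Balanced : V → Set
Balanced (x₁ , x₂ , x₃ , x₄) = x₁ + x₄ ≡ x₂ + x₃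

infix 4 _≟ⱽ_ _≤ⱽ_ _≤ⱽ?_

_≟ⱽ_ : (x y : V) → Dec (x ≡ y)
_≟ⱽ_ = ≡-dec ℕ._≟_ (≡-dec ℕ._≟_ (≡-dec ℕ._≟_ ℕ._≟_))

_≤ⱽ_ : V → V → Set
(x₁ , x₂ , x₃ , x₄) ≤ⱽ (y₁ , y₂ , y₃ , y₄) = x₁ ≤ y₁ × x₂ ≤ y₂ × x₃ ≤ y₃ × x₄ ≤ y₄

_≤ⱽ?_ : (x y : V) → Dec (x ≤ⱽ y)
(x₁ , x₂ , x₃ , x₄) ≤ⱽ? (y₁ , y₂ , y₃ , y₄) =
  (x₁ ℕ.≤? y₁) ×-dec ((x₂ ℕ.≤? y₂) ×-dec ((x₃ ℕ.≤? y₃) ×-dec (x₄ ℕ.≤? y₄)))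

∑-indicator : ∀ {s : V} {c} {xs} → Unique xs → (s∈? : Dec (s ∈ xs)) → ∑ (λ x → [ x ≟ⱽ s ] c) xs ≡ [ s∈? ] c
∑-indicator [] (no _) = refl
∑-indicator {s} {c} {x ∷ xs} (x∉xs ∷ xs!) s∈? with x ≟ⱽ s | ∑-indicator {c = c} xs! (any? (s ≟ⱽ_) xs)
... | yes refl | ih = trans
  (cong (c +ᶻ_) (trans ih ([]-⇔ (any? (s ≟ⱽ_) xs) (no λ s∈xs → All.lookup x∉xs s∈xs refl) id id)))
  (trans (ℤ.+-identityʳ c) ([]-⇔ (yes (here refl)) s∈? id id))
... | no  x≢s  | ih = trans (ℤ.+-identityˡ _) (trans ih
  ([]-⇔ (any? (s ≟ⱽ_) xs) s∈? there λ { (here s≡x) → contradiction (sym s≡x) x≢s ; (there s∈xs) → s∈xs }))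

-- The expansion of (1 - z₁z₂)(1 - z₁z₃)(1 - z₂z₄)(1 - z₃z₄).
numerator : List (ℤ × V)
numerator =
  (1ℤ , 0 , 0 , 0 , 0) ∷
  (- 1ℤ , 1 , 1 , 0 , 0) ∷ (- 1ℤ , 1 , 0 , 1 , 0) ∷ (- 1ℤ , 0 , 1 , 0 , 1) ∷ (- 1ℤ , 0 , 0 , 1 , 1) ∷
  -- The 2 reflects the relation of the monoid: two pairs of factors have the product z₁z₂z₃z₄.
  (+ 2 , 1 , 1 , 1 , 1) ∷
  (1ℤ , 2 , 1 , 1 , 0) ∷ (1ℤ , 1 , 2 , 0 , 1) ∷ (1ℤ , 1 , 0 , 2 , 1) ∷ (1ℤ , 0 , 1 , 1 , 2) ∷
  (- 1ℤ , 2 , 2 , 1 , 1) ∷ (- 1ℤ , 2 , 1 , 2 , 1) ∷ (- 1ℤ , 1 , 2 , 1 , 2) ∷ (- 1ℤ , 1 , 1 , 2 , 2) ∷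
  (1ℤ , 2 , 2 , 2 , 2) ∷ []

numerator-balanced : All (Balanced ∘ proj₂) numerator
numerator-balanced =
  refl ∷ refl ∷ refl ∷ refl ∷ refl ∷ refl ∷ refl ∷ refl ∷
  refl ∷ refl ∷ refl ∷ refl ∷ refl ∷ refl ∷ refl ∷ []

coefficient : V → ℤ
coefficient x = ∑ (λ (c , s) → [ x ≟ⱽ s ] c) numerator

-- Coefficients of (1 - z₁z₂)(1 - z₁z₃)(1 - z₂z₄)(1 - z₃z₄) / (1 - z₁z₂z₃z₄).
μⱽ : ℕ → ℕ → ℕ → ℕ → ℤ
μⱽ x₁@(suc y₁) x₂@(suc y₂) x₃@(suc y₃) x₄@(suc y₄) = coefficient (x₁ , x₂ , x₃ , x₄) +ᶻ μⱽ y₁ y₂ y₃ y₄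
μⱽ x₁ x₂ x₃ x₄ = coefficient (x₁ , x₂ , x₃ , x₄)

möbius : V → ℤ
möbius (x₁ , x₂ , x₃ , x₄) = μⱽ x₁ x₂ x₃ x₄

-- The effect on exponents of multiplying a series by z₁z₂z₃z₄. `nothing` is an exponent outside ℕ⁴,
-- whose coefficient is 0; hence the default `0ℤ` wherever `maybe` is applied to it.
predⱽ : V → Maybe V
predⱽ (suc x₁ , suc x₂ , suc x₃ , suc x₄) = just (x₁ , x₂ , x₃ , x₄)
predⱽ _                                   = nothing

sucⱽ : V → V
sucⱽ (x₁ , x₂ , x₃ , x₄) = suc x₁ , suc x₂ , suc x₃ , suc x₄

möbius-pred : ∀ x → möbius x ≡ coefficient x +ᶻ maybe möbius 0ℤ (predⱽ x)
möbius-pred (suc _ , suc _ , suc _ , suc _) = refl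
möbius-pred (zero  , _     , _     , _)     = sym (ℤ.+-identityʳ _)
möbius-pred (suc _ , zero  , _     , _)     = sym (ℤ.+-identityʳ _)
möbius-pred (suc _ , suc _ , zero  , _)     = sym (ℤ.+-identityʳ _)
möbius-pred (suc _ , suc _ , suc _ , zero)  = sym (ℤ.+-identityʳ _)

predⱽ-just : ∀ {x y} → predⱽ x ≡ just y → x ≡ sucⱽ y
predⱽ-just {suc _ , suc _ , suc _ , suc _} refl = refl

δ : V → ℤ
δ (0 , 0 , 0 , 0) = 1ℤ
δ _               = 0ℤ

-- The numerator times the series ∑ z^x over balanced x is 1 - z₁z₂z₃z₄.
Identity : V → Set
Identity e = ∑ (λ (c , s) → [ s ≤ⱽ? e ] c) numerator +ᶻ maybe δ 0ℤ (predⱽ e) ≡ δ e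

-- No exponent of the numerator exceeds 2, so both sides only see whether i, k and l
-- are 0, 1 or larger.
interval-identity₁ : ∀ i k l → Identity (i , i + k , l , k + l)
interval-identity₂ : ∀ i k l → Identity (i + k , i , k + l , l)
interval-identity₁ 0 0 0 = refl
interval-identity₁ 0 0 1 = refl
interval-identity₁ 0 0 (2+ l) = refl
interval-identity₁ 0 1 0 = refl
interval-identity₁ 0 1 1 = refl
interval-identity₁ 0 1 (2+ l) = refl
interval-identity₁ 0 (2+ k) 0 = refl
interval-identity₁ 0 (2+ k) 1 = refl
interval-identity₁ 0 (2+ k) (2+ l) = refl
interval-identity₁ 1 0 0 = refl
interval-identity₁ 1 0 1 = refl
interval-identity₁ 1 0 (2+ l) = refl
interval-identity₁ 1 1 0 = refl
interval-identity₁ 1 1 1 = refl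
interval-identity₁ 1 1 (2+ l) = refl
interval-identity₁ 1 (2+ k) 0 = refl
interval-identity₁ 1 (2+ k) 1 = refl
interval-identity₁ 1 (2+ k) (2+ l) = refl
interval-identity₁ (2+ i) 0 0 = refl
interval-identity₁ (2+ i) 0 1 = refl
interval-identity₁ (2+ i) 0 (2+ l) = refl
interval-identity₁ (2+ i) 1 0 = refl
interval-identity₁ (2+ i) 1 1 = refl
interval-identity₁ (2+ i) 1 (2+ l) = refl
interval-identity₁ (2+ i) (2+ k) 0 = refl
interval-identity₁ (2+ i) (2+ k) 1 = refl
interval-identity₁ (2+ i) (2+ k) (2+ l) = refl

interval-identity₂ 0 0 0 = refl
interval-identity₂ 0 0 1 = refl
interval-identity₂ 0 0 (2+ l) = refl
interval-identity₂ 0 1 0 = refl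
interval-identity₂ 0 1 1 = refl
interval-identity₂ 0 1 (2+ l) = refl
interval-identity₂ 0 (2+ k) 0 = refl
interval-identity₂ 0 (2+ k) 1 = refl
interval-identity₂ 0 (2+ k) (2+ l) = refl
interval-identity₂ 1 0 0 = refl
interval-identity₂ 1 0 1 = refl
interval-identity₂ 1 0 (2+ l) = refl
interval-identity₂ 1 1 0 = refl
interval-identity₂ 1 1 1 = refl
interval-identity₂ 1 1 (2+ l) = refl
interval-identity₂ 1 (2+ k) 0 = refl
interval-identity₂ 1 (2+ k) 1 = refl
interval-identity₂ 1 (2+ k) (2+ l) = refl
interval-identity₂ (2+ i) 0 0 = refl
interval-identity₂ (2+ i) 0 1 = refl
interval-identity₂ (2+ i) 0 (2+ l) = refl
interval-identity₂ (2+ i) 1 0 = refl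
interval-identity₂ (2+ i) 1 1 = refl
interval-identity₂ (2+ i) 1 (2+ l) = refl
interval-identity₂ (2+ i) (2+ k) 0 = refl
interval-identity₂ (2+ i) (2+ k) 1 = refl
interval-identity₂ (2+ i) (2+ k) (2+ l) = refl

-- Both families are needed: a balanced vector is a combination of (1,1,0,0),
-- (0,0,1,1) and either (0,1,0,1) or (1,0,1,0).
interval-identity : ∀ e → Balanced e → Identity e
interval-identity (e₁ , e₂ , e₃ , e₄) bal with ℕ.≤-total e₁ e₂
... | inj₁ e₁≤e₂ with k , refl ← ℕ.m≤n⇒∃[o]m+o≡n e₁≤e₂
    with refl ← ℕ.+-cancelˡ-≡ e₁ e₄ (k + e₃) (trans bal (ℕ.+-assoc e₁ k e₃)) = interval-identity₁ e₁ k e₃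
... | inj₂ e₂≤e₁ with k , refl ← ℕ.m≤n⇒∃[o]m+o≡n e₂≤e₁
    with refl ← ℕ.+-cancelˡ-≡ e₂ e₃ (k + e₄) (trans (sym bal) (ℕ.+-assoc e₂ k e₄)) = interval-identity₂ e₂ k e₄

∑-mapMaybe : {A B : Set} (f : B → ℤ) (g : A → Maybe B) → ∀ xs →
             ∑ (maybe f 0ℤ ∘ g) xs ≡ ∑ f (List.mapMaybe g xs)
∑-mapMaybe f g []       = refl
∑-mapMaybe f g (x ∷ xs) with g x
... | just y  = cong (f y +ᶻ_) (∑-mapMaybe f g xs)
... | nothing = trans (ℤ.+-identityˡ _) (∑-mapMaybe f g xs)

∈-mapMaybe-predⱽ⁻ : ∀ {y} xs → y ∈ List.mapMaybe predⱽ xs → sucⱽ y ∈ xs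
∈-mapMaybe-predⱽ⁻ (x ∷ xs) y∈ with predⱽ x in eq | y∈
... | just _  | here refl = here (sym (predⱽ-just eq))
... | just _  | there y∈′ = there (∈-mapMaybe-predⱽ⁻ xs y∈′)
... | nothing | y∈′       = there (∈-mapMaybe-predⱽ⁻ xs y∈′)

∈-mapMaybe-predⱽ⁺ : ∀ {y} xs → sucⱽ y ∈ xs → y ∈ List.mapMaybe predⱽ xs
∈-mapMaybe-predⱽ⁺ (x ∷ xs) (here refl) = here refl
∈-mapMaybe-predⱽ⁺ (x ∷ xs) (there sy∈) with predⱽ x
... | just _  = there (∈-mapMaybe-predⱽ⁺ xs sy∈)
... | nothing = ∈-mapMaybe-predⱽ⁺ xs sy∈

mapMaybe-predⱽ-unique : ∀ {xs} → Unique xs → Unique (List.mapMaybe predⱽ xs)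
mapMaybe-predⱽ-unique [] = []
mapMaybe-predⱽ-unique {x ∷ xs} (x∉xs ∷ xs!) with predⱽ x in eq
... | just y  = All.tabulate (λ z∈ y≡z → All.lookup x∉xs (∈-mapMaybe-predⱽ⁻ xs z∈)
                  (trans (predⱽ-just eq) (cong sucⱽ y≡z))) ∷ mapMaybe-predⱽ-unique xs!
... | nothing = mapMaybe-predⱽ-unique xs!

-- Abstracts from the order of the list: such lists arise both from intervals of permutations and
-- from other lists by `predⱽ`.
record Enumerates (e : V) (xs : List V) : Set where
  field
    unique   : Unique xs
    sound    : ∀ {x} → x ∈ xs → Balanced x × x ≤ⱽ e
    complete : ∀ {x} → Balanced x → x ≤ⱽ e → x ∈ xs

balanced-suc : ∀ {x} → Balanced x → Balanced (sucⱽ x)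
balanced-suc {x₁ , x₂ , x₃ , x₄} bal = cong suc (trans (ℕ.+-suc x₁ x₄) (trans (cong suc bal) (sym (ℕ.+-suc x₂ x₃))))

balanced-pred : ∀ {x} → Balanced (sucⱽ x) → Balanced x
balanced-pred {x₁ , x₂ , x₃ , x₄} bal =
  ℕ.suc-injective (trans (sym (ℕ.+-suc x₁ x₄)) (trans (ℕ.suc-injective bal) (ℕ.+-suc x₂ x₃)))

enumerates-pred : ∀ {e xs} → Enumerates (sucⱽ e) xs → Enumerates e (List.mapMaybe predⱽ xs)
enumerates-pred {e} {xs} enum = record
  { unique   = mapMaybe-predⱽ-unique unique
  ; sound    = λ x∈ → let bal , (p₁ , p₂ , p₃ , p₄) = sound (∈-mapMaybe-predⱽ⁻ xs x∈) in
                 balanced-pred bal , (s≤s⁻¹ p₁ , s≤s⁻¹ p₂ , s≤s⁻¹ p₃ , s≤s⁻¹ p₄)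
  ; complete = λ bal (p₁ , p₂ , p₃ , p₄) →
                 ∈-mapMaybe-predⱽ⁺ xs (complete (balanced-suc bal) (s≤s p₁ , s≤s p₂ , s≤s p₃ , s≤s p₄))
  }
  where open Enumerates enum

enumerates-nothing : ∀ {e xs} → Enumerates e xs → predⱽ e ≡ nothing → List.mapMaybe predⱽ xs ≡ []
enumerates-nothing {e} {xs} enum eq = empty λ y∈ →
  just≰nothing (proj₂ (Enumerates.sound enum (∈-mapMaybe-predⱽ⁻ xs y∈))) eq
  where
  empty : ∀ {ys : List V} → (∀ {y} → ¬ y ∈ ys) → ys ≡ []
  empty {[]}    _  = refl
  empty {_ ∷ _} ∉ = contradiction (here refl) ∉
  just≰nothing : ∀ {y e} → sucⱽ y ≤ⱽ e → ¬ predⱽ e ≡ nothing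
  just≰nothing (s≤s _ , s≤s _ , s≤s _ , s≤s _) ()

∑-coefficient : ∀ {e xs} → Enumerates e xs → ∑ coefficient xs ≡ ∑ (λ (c , s) → [ s ≤ⱽ? e ] c) numerator
∑-coefficient {e} {xs} enum = trans (∑-swap (λ x (c , s) → [ x ≟ⱽ s ] c) xs numerator) (go numerator-balanced)
  where
  open Enumerates enum
  go : ∀ {ts} → All (Balanced ∘ proj₂) ts →
       ∑ (λ (c , s) → ∑ (λ x → [ x ≟ⱽ s ] c) xs) ts ≡ ∑ (λ (c , s) → [ s ≤ⱽ? e ] c) ts
  go [] = refl
  go {(c , s) ∷ _} (bal ∷ bals) = cong₂ _+ᶻ_
    (trans (∑-indicator unique (any? (s ≟ⱽ_) xs)) ([]-⇔ (any? (s ≟ⱽ_) xs) (s ≤ⱽ? e) (proj₂ ∘ sound) (complete bal)))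
    (go bals)

-- Summing `möbius-pred` leaves a sum of coefficients, which counts the exponents of the numerator
-- below e with weights, and a sum of `möbius` over the predecessors. The latter enumerate the
-- vectors below `predⱽ e`, so induction on e applies.
∑-möbius : ∀ {e xs} → Balanced e → Enumerates e xs → ∑ möbius xs ≡ δ e
∑-möbius′ : ∀ {e xs} → Balanced e → Enumerates e xs → ∑ möbius (List.mapMaybe predⱽ xs) ≡ maybe δ 0ℤ (predⱽ e)

∑-möbius {e} {xs} bal enum = begin
  ∑ möbius xs
    ≡⟨ ∑-cong möbius-pred xs ⟩
  ∑ (λ x → coefficient x +ᶻ maybe möbius 0ℤ (predⱽ x)) xs
    ≡⟨ ∑-+ coefficient (maybe möbius 0ℤ ∘ predⱽ) xs ⟩
  ∑ coefficient xs +ᶻ ∑ (maybe möbius 0ℤ ∘ predⱽ) xs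
    ≡⟨ cong₂ _+ᶻ_ (∑-coefficient enum) (trans (∑-mapMaybe möbius predⱽ xs) (∑-möbius′ bal enum)) ⟩
  ∑ (λ (c , s) → [ s ≤ⱽ? e ] c) numerator +ᶻ maybe δ 0ℤ (predⱽ e)
    ≡⟨ interval-identity e bal ⟩
  δ e ∎
  where open ≡-Reasoning

∑-möbius′ {suc e₁ , suc e₂ , suc e₃ , suc e₄} bal enum = ∑-möbius (balanced-pred bal) (enumerates-pred enum)
∑-möbius′ {zero , _ , _ , _} bal enum = cong (∑ möbius) (enumerates-nothing enum refl)
∑-möbius′ {suc _ , zero , _ , _} bal enum = cong (∑ möbius) (enumerates-nothing enum refl)
∑-möbius′ {suc _ , suc _ , zero , _} bal enum = cong (∑ möbius) (enumerates-nothing enum refl)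
∑-möbius′ {suc _ , suc _ , suc _ , zero} bal enum = cong (∑ möbius) (enumerates-nothing enum refl)

-- Evaluation in the seven cases

möbius-suc : ∀ x → coefficient (sucⱽ x) ≡ 0ℤ → möbius (sucⱽ x) ≡ möbius x
möbius-suc x eq = trans (cong (_+ᶻ möbius x) eq) (ℤ.+-identityˡ (möbius x))

sum≡3 : ∀ x y → suc x + suc y ≡ 3 → (x ≡ 0 × y ≡ 1) ⊎ (x ≡ 1 × y ≡ 0)
sum≡3 0      .1 refl = inj₁ (refl , refl)
sum≡3 1      .0 refl = inj₂ (refl , refl)
sum≡3 (2+ x) y  eq   with () ← trans (sym (ℕ.+-suc x y)) (ℕ.+-cancelˡ-≡ 3 (x + suc y) 0 eq)

≡+1 : ∀ {x} a → suc x ≡ suc a + 1 → x ≡ suc a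
≡+1 a eq = trans (ℕ.suc-injective eq) (ℕ.+-comm a 1)

module _ (x₁ x₂ x₃ x₄ : ℕ) where

  private
    μx = möbius (x₁ , x₂ , x₃ , x₄)

  möbius-case₁ : Case₁ (suc x₁) (suc x₂) (suc x₃) (suc x₄) → μx ≡ + 1
  möbius-case₁ (refl , refl , refl , refl) = refl

  möbius-case₂ : Case₂ (suc x₁) (suc x₂) (suc x₃) (suc x₄) → μx ≡ - (+ 1)
  möbius-case₂ (p , q) with sum≡3 x₁ x₄ p | sum≡3 x₂ x₃ q
  ... | inj₁ (refl , refl) | inj₁ (refl , refl) = refl
  ... | inj₁ (refl , refl) | inj₂ (refl , refl) = refl
  ... | inj₂ (refl , refl) | inj₁ (refl , refl) = refl
  ... | inj₂ (refl , refl) | inj₂ (refl , refl) = refl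

  möbius-case₃ : Case₃ (suc x₁) (suc x₂) (suc x₃) (suc x₄) → μx ≡ + 3
  möbius-case₃ (refl , refl , refl , refl) = refl

  möbius-case₄ : Case₄ (suc x₁) (suc x₂) (suc x₃) (suc x₄) → μx ≡ + 4
  möbius-case₄ (_ , s≤s (s≤s (s≤s {n = k} z≤n)) , refl , refl , refl , refl) = go k
    where
    -- Vectors are compared from the first entry on, so `refl` shows that a coefficient vanishes
    -- once the first entry is visibly at least 3, beyond every exponent of the numerator. Here and
    -- in the later cases the base clauses cover the smaller first entries.
    go : ∀ k → möbius (2+ k , 2+ k , 2+ k , 2+ k) ≡ + 4
    go zero    = refl
    go (suc k) = trans (möbius-suc (2+ k , 2+ k , 2+ k , 2+ k) refl) (go k)

  möbius-case₅ : Case₅ (suc x₁) (suc x₂) (suc x₃) (suc x₄) → μx ≡ + 1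
  möbius-case₅ (inj₁ (_ , s≤s (s≤s {n = k} z≤n) , refl , refl , inj₁ (eq , refl))) with refl ← ≡+1 (suc k) eq = go k
    where
    go : ∀ k → möbius (1 + k , 2+ k , k , 1 + k) ≡ + 1
    go 0 = refl
    go 1 = refl
    go (suc k@(suc _)) = trans (möbius-suc (1 + k , 2+ k , k , 1 + k) refl) (go k)
  möbius-case₅ (inj₁ (_ , s≤s (s≤s {n = k} z≤n) , refl , refl , inj₂ (refl , eq))) with refl ← ≡+1 (suc k) eq = go k
    where
    go : ∀ k → möbius (1 + k , k , 2+ k , 1 + k) ≡ + 1
    go 0 = refl
    go 1 = refl
    go (suc k@(suc _)) = trans (möbius-suc (1 + k , k , 2+ k , 1 + k) refl) (go k)
  möbius-case₅ (inj₂ (_ , s≤s (s≤s {n = k} z≤n) , refl , refl , inj₁ (eq , refl))) with refl ← ≡+1 (suc k) eq = go k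
    where
    go : ∀ k → möbius (2+ k , 1 + k , 1 + k , k) ≡ + 1
    go zero    = refl
    go (suc k) = trans (möbius-suc (2+ k , 1 + k , 1 + k , k) refl) (go k)
  möbius-case₅ (inj₂ (_ , s≤s (s≤s {n = k} z≤n) , refl , refl , inj₂ (refl , eq))) with refl ← ≡+1 (suc k) eq = go k
    where
    go : ∀ k → möbius (k , 1 + k , 1 + k , 2+ k) ≡ + 1
    go 0 = refl
    go 1 = refl
    go 2 = refl
    go (suc k@(2+ _)) = trans (möbius-suc (k , 1 + k , 1 + k , 2+ k) refl) (go k)

  möbius-case₆ : Case₆ (suc x₁) (suc x₂) (suc x₃) (suc x₄) → μx ≡ - (+ 2)
  möbius-case₆ (_ , s≤s (s≤s {n = k} z≤n) , inj₁ (refl , eq) , inj₁ (refl , eq′))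
    with refl ← ≡+1 (suc k) eq | refl ← ≡+1 (suc k) eq′ = go k
    where
    go : ∀ k → möbius (1 + k , 1 + k , 2+ k , 2+ k) ≡ - (+ 2)
    go 0 = refl
    go 1 = refl
    go (suc k@(suc _)) = trans (möbius-suc (1 + k , 1 + k , 2+ k , 2+ k) refl) (go k)
  möbius-case₆ (_ , s≤s (s≤s {n = k} z≤n) , inj₁ (refl , eq) , inj₂ (eq′ , refl))
    with refl ← ≡+1 (suc k) eq | refl ← ≡+1 (suc k) eq′ = go k
    where
    go : ∀ k → möbius (1 + k , 2+ k , 1 + k , 2+ k) ≡ - (+ 2)
    go 0 = refl
    go 1 = refl
    go (suc k@(suc _)) = trans (möbius-suc (1 + k , 2+ k , 1 + k , 2+ k) refl) (go k)
  möbius-case₆ (_ , s≤s (s≤s {n = k} z≤n) , inj₂ (eq , refl) , inj₁ (refl , eq′))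
    with refl ← ≡+1 (suc k) eq | refl ← ≡+1 (suc k) eq′ = go k
    where
    go : ∀ k → möbius (2+ k , 1 + k , 2+ k , 1 + k) ≡ - (+ 2)
    go zero    = refl
    go (suc k) = trans (möbius-suc (2+ k , 1 + k , 2+ k , 1 + k) refl) (go k)
  möbius-case₆ (_ , s≤s (s≤s {n = k} z≤n) , inj₂ (eq , refl) , inj₂ (eq′ , refl))
    with refl ← ≡+1 (suc k) eq | refl ← ≡+1 (suc k) eq′ = go k
    where
    go : ∀ k → möbius (2+ k , 2+ k , 1 + k , 1 + k) ≡ - (+ 2)
    go zero    = refl
    go (suc k) = trans (möbius-suc (2+ k , 2+ k , 1 + k , 1 + k) refl) (go k)

module _ (d₁ d₂ d₃ d₄ : ℕ) where

  SomeCase : Set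
  SomeCase = Case₁ d₁ d₂ d₃ d₄ ⊎ Case₂ d₁ d₂ d₃ d₄ ⊎ Case₃ d₁ d₂ d₃ d₄ ⊎
             Case₄ d₁ d₂ d₃ d₄ ⊎ Case₅ d₁ d₂ d₃ d₄ ⊎ Case₆ d₁ d₂ d₃ d₄

pattern in₁ x = inj₁ x
pattern in₂ x = inj₂ (inj₁ x)
pattern in₃ x = inj₂ (inj₂ (inj₁ x))
pattern in₄ x = inj₂ (inj₂ (inj₂ (inj₁ x)))
pattern in₅ x = inj₂ (inj₂ (inj₂ (inj₂ (inj₁ x))))
pattern in₆ x = inj₂ (inj₂ (inj₂ (inj₂ (inj₂ x))))

-- Along a diagonal, case 1 leads to 3 and 3 to 4, case 2 leads to 6, and cases 4, 5 and 6 lead to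
-- themselves.
someCase-suc : ∀ x₁ x₂ x₃ x₄ → SomeCase (suc x₁) (suc x₂) (suc x₃) (suc x₄) →
               SomeCase (2+ x₁) (2+ x₂) (2+ x₃) (2+ x₄)
someCase-suc _ _ _ _ (in₁ (refl , refl , refl , refl)) = in₃ (refl , refl , refl , refl)
someCase-suc x₁ x₂ x₃ x₄ (in₂ (p , q)) = in₆ (2 , ℕ.≤-refl , split x₁ x₄ p , split x₂ x₃ q)
  where
  split : ∀ x y → suc x + suc y ≡ 3 → (2+ x ≡ 2 × 2+ y ≡ 3) ⊎ (2+ x ≡ 3 × 2+ y ≡ 2)
  split x y eq with sum≡3 x y eq
  ... | inj₁ (refl , refl) = inj₁ (refl , refl)
  ... | inj₂ (refl , refl) = inj₂ (refl , refl)
someCase-suc _ _ _ _ (in₃ (refl , refl , refl , refl)) = in₄ (3 , ℕ.≤-refl , refl , refl , refl , refl)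
someCase-suc _ _ _ _ (in₄ (a , 3≤a , refl , refl , refl , refl)) =
  in₄ (suc a , ℕ.m≤n⇒m≤1+n 3≤a , refl , refl , refl , refl)
-- Exposing `a` as `2+ _` lets `a ∸ 1` compute, so that it commutes with the shift.
someCase-suc _ _ _ _ (in₅ (inj₁ (a@(2+ _) , 2≤a , refl , refl , inj₁ (eq , refl)))) =
  in₅ (inj₁ (suc a , ℕ.m≤n⇒m≤1+n 2≤a , refl , refl , inj₁ (cong suc eq , refl)))
someCase-suc _ _ _ _ (in₅ (inj₁ (a@(2+ _) , 2≤a , refl , refl , inj₂ (refl , eq)))) =
  in₅ (inj₁ (suc a , ℕ.m≤n⇒m≤1+n 2≤a , refl , refl , inj₂ (refl , cong suc eq)))
someCase-suc _ _ _ _ (in₅ (inj₂ (a@(2+ _) , 2≤a , refl , refl , inj₁ (eq , refl)))) =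
  in₅ (inj₂ (suc a , ℕ.m≤n⇒m≤1+n 2≤a , refl , refl , inj₁ (cong suc eq , refl)))
someCase-suc _ _ _ _ (in₅ (inj₂ (a@(2+ _) , 2≤a , refl , refl , inj₂ (refl , eq)))) =
  in₅ (inj₂ (suc a , ℕ.m≤n⇒m≤1+n 2≤a , refl , refl , inj₂ (refl , cong suc eq)))
someCase-suc _ _ _ _ (in₆ (a , 2≤a , p , q)) = in₆ (suc a , ℕ.m≤n⇒m≤1+n 2≤a , step p , step q)
  where
  step : ∀ {x y a} → (x ≡ a × y ≡ a + 1) ⊎ (x ≡ a + 1 × y ≡ a) →
         (suc x ≡ suc a × suc y ≡ suc a + 1) ⊎ (suc x ≡ suc a + 1 × suc y ≡ suc a)
  step (inj₁ (p , q)) = inj₁ (cong suc p , cong suc q)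
  step (inj₂ (p , q)) = inj₂ (cong suc p , cong suc q)

SomeCaseⱽ : V → Set
SomeCaseⱽ (x₁ , x₂ , x₃ , x₄) = SomeCase (suc x₁) (suc x₂) (suc x₃) (suc x₄)

numerator-cases : All (SomeCaseⱽ ∘ proj₂) numerator
numerator-cases =
  in₁ (refl , refl , refl , refl) ∷
  in₂ (refl , refl) ∷ in₂ (refl , refl) ∷ in₂ (refl , refl) ∷ in₂ (refl , refl) ∷
  in₃ (refl , refl , refl , refl) ∷
  in₅ (inj₂ (2 , ℕ.≤-refl , refl , refl , inj₁ (refl , refl))) ∷
  in₅ (inj₁ (2 , ℕ.≤-refl , refl , refl , inj₁ (refl , refl))) ∷
  in₅ (inj₁ (2 , ℕ.≤-refl , refl , refl , inj₂ (refl , refl))) ∷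
  in₅ (inj₂ (2 , ℕ.≤-refl , refl , refl , inj₂ (refl , refl))) ∷
  in₆ (2 , ℕ.≤-refl , inj₂ (refl , refl) , inj₂ (refl , refl)) ∷
  in₆ (2 , ℕ.≤-refl , inj₂ (refl , refl) , inj₁ (refl , refl)) ∷
  in₆ (2 , ℕ.≤-refl , inj₁ (refl , refl) , inj₂ (refl , refl)) ∷
  in₆ (2 , ℕ.≤-refl , inj₁ (refl , refl) , inj₁ (refl , refl)) ∷
  in₄ (3 , ℕ.≤-refl , refl , refl , refl , refl) ∷ []

coefficient-cases : ∀ x → coefficient x ≡ 0ℤ ⊎ SomeCaseⱽ x
coefficient-cases x = go numerator-cases
  where
  go : ∀ {ts} → All (SomeCaseⱽ ∘ proj₂) ts → ∑ (λ (c , s) → [ x ≟ⱽ s ] c) ts ≡ 0ℤ ⊎ SomeCaseⱽ x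
  go [] = inj₁ refl
  go {(c , s) ∷ ts} (p ∷ ps) with x ≟ⱽ s
  ... | yes refl = inj₂ p
  ... | no  _ with go ps
  ...   | inj₁ eq = inj₁ (trans (ℤ.+-identityˡ _) eq)
  ...   | inj₂ q  = inj₂ q

-- If no coefficient on the diagonal down from x is nonzero, the value is 0. Otherwise an exponent
-- of the numerator lies there; it belongs to a case, and `someCase-suc` carries this up to x.
möbius-cases : ∀ x₁ x₂ x₃ x₄ → möbius (x₁ , x₂ , x₃ , x₄) ≡ 0ℤ ⊎ SomeCase (suc x₁) (suc x₂) (suc x₃) (suc x₄)
möbius-cases (suc x₁) (suc x₂) (suc x₃) (suc x₄)
  with coefficient-cases (suc x₁ , suc x₂ , suc x₃ , suc x₄)
... | inj₂ p = inj₂ p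
... | inj₁ eq with möbius-cases x₁ x₂ x₃ x₄
...   | inj₁ eq′ = inj₁ (trans (möbius-suc (x₁ , x₂ , x₃ , x₄) eq) eq′)
...   | inj₂ p   = inj₂ (someCase-suc x₁ x₂ x₃ x₄ p)
möbius-cases zero x₂ x₃ x₄ = coefficient-cases (zero , x₂ , x₃ , x₄)
möbius-cases (suc x₁) zero x₃ x₄ = coefficient-cases (suc x₁ , zero , x₃ , x₄)
möbius-cases (suc x₁) (suc x₂) zero x₄ = coefficient-cases (suc x₁ , suc x₂ , zero , x₄)
möbius-cases (suc x₁) (suc x₂) (suc x₃) zero = coefficient-cases (suc x₁ , suc x₂ , suc x₃ , zero)

-- Intervals of bigrassmannian permutations

collect-outer : ∀ a k h l x y → a + x + k + h + (l + y) ≡ a + k + h + l + (x + y)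
collect-outer = solve-∀

collect-inner : ∀ a k h l x y → a + (k + y) + (h + x) + l ≡ a + k + h + l + (x + y)
collect-inner = solve-∀

params : {ω : Permutation′ n} → Block ω → V
params b = a , h , k , l
  where open Block b

difference : V → V → V
difference (a , h , k , l) (a′ , h′ , k′ , l′) = a ∸ a′ , h′ ∸ h , k′ ∸ k , l ∸ l′

offset : {π ω : Permutation′ n} → Block π → Block ω → V
offset bπ bω = difference (params bπ) (params bω)

≼-antisym : {π σ : Permutation′ n} {bπ : Block π} {bσ : Block σ} → bπ ≼ bσ → bσ ≼ bπ → params bπ ≡ params bσ
≼-antisym p q = cong₂ _,_ (ℕ.≤-antisym q.a≥ p.a≥) (cong₂ _,_ (ℕ.≤-antisym p.h≤ q.h≤)
  (cong₂ _,_ (ℕ.≤-antisym p.k≤ q.k≤) (ℕ.≤-antisym q.l≥ p.l≥)))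
  where
  module p = _≼_ p
  module q = _≼_ q

-- Equal permutations are comparable both ways, so antisymmetry of `≼` makes the parameters unique.
-- This reconciles a given `Block` with the one found by `classify`.
params-cong : {π σ : Permutation′ n} (bπ : Block π) (bσ : Block σ) → π ≈ₚ σ → params bπ ≡ params bσ
params-cong bπ bσ π≈σ = ≼-antisym (≤ᴮ⇒≼ bπ bσ (done π≈σ)) (≤ᴮ⇒≼ bσ bπ (done (sym ∘ π≈σ)))

params-injective : {π σ : Permutation′ n} (bπ : Block π) (bσ : Block σ) → params bπ ≡ params bσ → π ≈ₚ σ
params-injective {π = π} {σ} (mkBlock _ _ _ _ _ _ _ isπ) (mkBlock _ _ _ _ _ _ _ isσ) refl =
  isBlockSwap-unique {ω = π} isπ {σ} isσ

offset-self : {π : Permutation′ n} (bπ : Block π) → offset bπ bπ ≡ (0 , 0 , 0 , 0)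
offset-self bπ = cong₂ _,_ (ℕ.n∸n≡0 a) (cong₂ _,_ (ℕ.n∸n≡0 h) (cong₂ _,_ (ℕ.n∸n≡0 k) (ℕ.n∸n≡0 l)))
  where open Block bπ

module _ {π ω : Permutation′ n} {bπ : Block π} {bω : Block ω} (π≼ω : bπ ≼ bω) where
  private
    module π = Block bπ
    module ω = Block bω
  open _≼_ π≼ω

  offset-balanced : Balanced (offset bπ bω)
  offset-balanced = cancel {ω.a} {l = ω.l} {x₁ = π.a ∸ ω.a} {x₄ = π.l ∸ ω.l}
    (ℕ.m+[n∸m]≡n a≥) (ℕ.m+[n∸m]≡n h≤) (ℕ.m+[n∸m]≡n k≤) (ℕ.m+[n∸m]≡n l≥)
    (trans π.sum≡n (sym ω.sum≡n))
    where
    cancel : ∀ {a h k l a′ h′ k′ l′ x₁ x₂ x₃ x₄} → a + x₁ ≡ a′ → h′ + x₂ ≡ h → k′ + x₃ ≡ k → l + x₄ ≡ l′ →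
             a′ + k′ + h′ + l′ ≡ a + k + h + l → x₁ + x₄ ≡ x₂ + x₃
    cancel {a} {l = l} {h′ = h′} {k′} {x₁ = x₁} {x₂} {x₃} {x₄} refl refl refl refl eq =
      ℕ.+-cancelˡ-≡ (a + k′ + h′ + l) _ _
        (trans (sym (collect-outer a k′ h′ l x₁ x₄)) (trans eq (collect-inner a k′ h′ l x₂ x₃)))

  -- Truncated subtraction loses nothing here because ω and ρ both lie above π.
  offset-injective : {ρ : Permutation′ n} {bρ : Block ρ} → bπ ≼ bρ → offset bπ bω ≡ offset bπ bρ → ω ≈ₚ ρ
  offset-injective {bρ = bρ} π≼ρ eq = params-injective bω bρ (cong₂ _,_
    (ℕ.∸-cancelˡ-≡ a≥ ρ.a≥ (cong proj₁ eq)) (cong₂ _,_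
    (ℕ.∸-cancelʳ-≡ h≤ ρ.h≤ (cong (proj₁ ∘ proj₂) eq)) (cong₂ _,_
    (ℕ.∸-cancelʳ-≡ k≤ ρ.k≤ (cong (proj₁ ∘ proj₂ ∘ proj₂) eq))
    (ℕ.∸-cancelˡ-≡ l≥ ρ.l≥ (cong (proj₂ ∘ proj₂ ∘ proj₂) eq)))))
    where module ρ = _≼_ π≼ρ

  offset-mono : {σ : Permutation′ n} {bσ : Block σ} → bω ≼ bσ → offset bπ bω ≤ⱽ offset bπ bσ
  offset-mono ω≼σ = ℕ.∸-monoʳ-≤ π.a σ.a≥ , ℕ.∸-monoˡ-≤ π.h σ.h≤ , ℕ.∸-monoˡ-≤ π.k σ.k≤ , ℕ.∸-monoʳ-≤ π.l σ.l≥
    where module σ = _≼_ ω≼σ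

-- The lengths (a - x₁, h + x₂, k + x₃, l - x₄) add up to n because x is balanced; the bound on x
-- prevents truncation and keeps the result below σ.
offset-surjective : {π σ : Permutation′ n} {bπ : Block π} {bσ : Block σ} → bπ ≼ bσ →
  ∀ {x} → Balanced x → x ≤ⱽ offset bπ bσ →
  ∃₂ λ ω (bω : Block ω) → bπ ≼ bω × bω ≼ bσ × offset bπ bω ≡ x
offset-surjective {n} {bπ = bπ} {bσ} π≼σ {x₁ , x₂ , x₃ , x₄} bal (p₁ , p₂ , p₃ , p₄) =
  proj₁ block
  , mkBlock a h k l (ℕ.<-≤-trans π.0<h (ℕ.m≤m+n π.h x₂)) (ℕ.<-≤-trans π.0<k (ℕ.m≤m+n π.k x₃)) sum≡n (proj₂ block)
  , record { a≥ = ℕ.m∸n≤m π.a x₁ ; h≤ = ℕ.m≤m+n π.h x₂ ; k≤ = ℕ.m≤m+n π.k x₃ ; l≥ = ℕ.m∸n≤m π.l x₄ }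
  , record { a≥ = lower a≥ p₁ ; h≤ = upper h≤ p₂ ; k≤ = upper k≤ p₃ ; l≥ = lower l≥ p₄ }
  , cong₂ _,_ (ℕ.m∸[m∸n]≡n x₁≤a) (cong₂ _,_ (ℕ.m+n∸m≡n π.h x₂) (cong₂ _,_ (ℕ.m+n∸m≡n π.k x₃) (ℕ.m∸[m∸n]≡n x₄≤l)))
  where
  module π = Block bπ
  module σ = Block bσ
  open _≼_ π≼σ
  a = π.a ∸ x₁
  h = π.h + x₂
  k = π.k + x₃
  l = π.l ∸ x₄
  x₁≤a = ℕ.≤-trans p₁ (ℕ.m∸n≤m π.a σ.a)
  x₄≤l = ℕ.≤-trans p₄ (ℕ.m∸n≤m π.l σ.l)
  lower : ∀ {m m′ x} → m ≤ m′ → x ≤ m′ ∸ m → m ≤ m′ ∸ x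
  lower {m} {m′} {x} m≤m′ x≤ = ℕ.m+n≤o⇒m≤o∸n m
    (ℕ.≤-trans (ℕ.+-monoʳ-≤ m x≤) (ℕ.≤-reflexive (ℕ.m+[n∸m]≡n m≤m′)))
  upper : ∀ {m m′ x} → m ≤ m′ → x ≤ m′ ∸ m → m + x ≤ m′
  upper {m} {m′} {x} m≤m′ x≤ = ℕ.≤-trans (ℕ.+-monoʳ-≤ m x≤) (ℕ.≤-reflexive (ℕ.m+[n∸m]≡n m≤m′))
  sum≡n : a + k + h + l ≡ n
  sum≡n = trans (collect-inner a π.k π.h l x₂ x₃) (trans (cong (λ x → a + π.k + π.h + l + x) (sym bal))
    (trans (sym (collect-outer a π.k π.h l x₁ x₄)) (trans
      (cong₂ (λ a l → a + π.k + π.h + l) (ℕ.m∸n+n≡m x₁≤a) (ℕ.m∸n+n≡m x₄≤l)) π.sum≡n)))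
  block = blockSwap-exists a h k (subst (a + k + h ≤_) sum≡n (ℕ.m≤m+n _ l))

δ-≢0 : ∀ x → x ≢ (0 , 0 , 0 , 0) → δ x ≡ 0ℤ
δ-≢0 (zero  , zero  , zero  , zero)  x≢0 = contradiction refl x≢0
δ-≢0 (zero  , zero  , zero  , suc _) x≢0 = refl
δ-≢0 (zero  , zero  , suc _ , _)     x≢0 = refl
δ-≢0 (zero  , suc _ , _     , _)     x≢0 = refl
δ-≢0 (suc _ , _     , _     , _)     x≢0 = refl

+≡0⇒≡- : ∀ i j → i +ᶻ j ≡ 0ℤ → i ≡ - j
+≡0⇒≡- i j eq = trans (sym (ℤ.+-identityʳ i)) (trans (cong (i +ᶻ_) (sym (ℤ.+-inverseʳ j)))
  (trans (sym (ℤ.+-assoc i j (- j))) (trans (cong (_+ᶻ - j) eq) (ℤ.+-identityˡ (- j)))))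

module _ {n : ℕ} where
  private
    module B = FinitePoset (𝔅 n)
  open Möbius (𝔅 n)

  blockOf : (z : B.Carrier) → Block (proj₁ z)
  blockOf (ω , b) = classify {ω = ω} b

  module _ (π : B.Carrier) (bπ : Block (proj₁ π)) where

    offsetOf : B.Carrier → V
    offsetOf z = offset bπ (blockOf z)

    ≤⇒≼ : ∀ {z} → π B.≤ z → bπ ≼ blockOf z
    ≤⇒≼ {z} = ≤ᴮ⇒≼ bπ (blockOf z)

    -- The recursion for μ runs over a half-open interval; putting the offset of σ in front closes
    -- it, as `∑-möbius` requires.
    interval-enumerates : ∀ σ (bσ : Block (proj₁ σ)) → π B.≤ σ →
      Enumerates (offset bπ bσ) (offset bπ bσ ∷ List.map (offsetOf ∘ proj₁) [ π , σ ⟩)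
    interval-enumerates σ bσ π≤σ = record
      { unique   = All.map⁺ (All.universal distinct-from-σ [ π , σ ⟩)
                   ∷ AllPairs.map⁺ (AllPairs.map (λ {x} {y} → distinct x y) (select-allPairs interval? B.unique))
      ; sound    = sound
      ; complete = complete
      }
      where
      π≼σ = ≤ᴮ⇒≼ bπ bσ π≤σ
      e = offset bπ bσ
      interval? : ∀ z → Dec (π B.≤ z × z B.< σ)
      interval? z = (π B.≤? z) ×-dec (z B.<? σ)
      Interval = ∃ λ z → π B.≤ z × z B.< σ
      distinct-from-σ : (z : Interval) → e ≢ offsetOf (proj₁ z)
      distinct-from-σ (z , π≤z , _ , z≉σ) eq = z≉σ (sym ∘ offset-injective π≼σ (≤⇒≼ {z} π≤z) eq)
      distinct : (z z′ : Interval) → ¬ proj₁ z B.≈ proj₁ z′ → offsetOf (proj₁ z) ≢ offsetOf (proj₁ z′)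
      distinct (z , π≤z , _) (z′ , π≤z′ , _) z≉z′ eq =
        z≉z′ (offset-injective (≤⇒≼ {z} π≤z) (≤⇒≼ {z′} π≤z′) eq)
      sound : ∀ {x} → x ∈ e ∷ List.map (offsetOf ∘ proj₁) [ π , σ ⟩ → Balanced x × x ≤ⱽ e
      sound (here refl) = offset-balanced π≼σ , offset-mono π≼σ (≤ᴮ⇒≼ bσ bσ (done λ _ → refl))
      sound (there x∈) with (z , π≤z , z≤σ , _) , _ , refl ← ∈-map⁻ (offsetOf ∘ proj₁) x∈ =
        offset-balanced (≤⇒≼ {z} π≤z) , offset-mono (≤⇒≼ {z} π≤z) (≤ᴮ⇒≼ (blockOf z) bσ z≤σ)
      listed : (ω : Permutation′ n) (bω : Block ω) → bπ ≼ bω → bω ≼ bσ → Dec (ω ≈ₚ proj₁ σ) →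
               offset bπ bω ∈ e ∷ List.map (offsetOf ∘ proj₁) [ π , σ ⟩
      listed ω bω π≼ω ω≼σ (yes ω≈σ) = here (cong (difference (params bπ)) (params-cong bω bσ ω≈σ))
      -- The list of elements contains ω only up to `≈ₚ` and with another proof of being
      -- bigrassmannian, but offsets do not see the difference.
      listed ω bω π≼ω ω≼σ (no  ω≉σ) = there (Any.map⁺ (Any.map
        (λ {z} ω≈z → cong (difference (params bπ)) (params-cong bω (blockOf (proj₁ z)) ω≈z))
        (select-any interval? {Q = z₀ B.≈_} (λ {z} → in-interval {z}) (B.complete z₀))))
        where
        z₀ : B.Carrier
        z₀ = ω , block-bigrassmannian {ω = ω} bω
        in-interval : ∀ {z} → z₀ B.≈ z → π B.≤ z × z B.< σ
        in-interval {z} ω≈z = ≤ᴮ-respʳ ω≈z (≼⇒≤ᴮ bπ bω π≼ω)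
                            , ≤ᴮ-trans (done (sym ∘ ω≈z)) (≼⇒≤ᴮ bω bσ ω≼σ)
                            , λ z≈σ → ω≉σ λ i → trans (ω≈z i) (z≈σ i)
      complete : ∀ {x} → Balanced x → x ≤ⱽ e → x ∈ e ∷ List.map (offsetOf ∘ proj₁) [ π , σ ⟩
      complete bal x≤e =
        let ω , bω , π≼ω , ω≼σ , eq = offset-surjective π≼σ bal x≤e in
        subst (_∈ e ∷ List.map (offsetOf ∘ proj₁) [ π , σ ⟩) eq (listed ω bω π≼ω ω≼σ (ω ≟ₚ proj₁ σ))
    -- For π ≉ σ both functions sum to 0 over the closed interval, so they obey the same recursion.
    -- The statement is for every `bσ` because the induction hypothesis is applied to the blocks
    -- chosen by `blockOf`.
    μ≡möbius : ∀ σ (bσ : Block (proj₁ σ)) → π B.≤ σ → μ π σ ≡ möbius (offset bπ bσ)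
    μ≡möbius σ = go σ (B.<-wellFounded σ)
      where
      go : ∀ σ → Acc B._<_ σ → (bσ : Block (proj₁ σ)) → π B.≤ σ → μ π σ ≡ möbius (offset bπ bσ)
      step : ∀ σ → (∀ {z} → z B.< σ → Acc B._<_ z) → (bσ : Block (proj₁ σ)) → π B.≤ σ →
             Dec (π B.≈ σ) → μ π σ ≡ möbius (offset bπ bσ)
      go σ (acc rec) bσ π≤σ = step σ (λ {z} → rec {z}) bσ π≤σ (proj₁ π ≟ₚ proj₁ σ)
      step σ rec bσ π≤σ (yes π≈σ) = trans (μ-≈ {π} {σ} π≈σ) (sym (cong möbius
        (trans (cong (difference (params bπ)) (sym (params-cong bπ bσ π≈σ))) (offset-self bπ))))
      step σ rec bσ π≤σ (no π≉σ) = begin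
        μ π σ
          ≡⟨ μ-≉ {π} {σ} π≉σ ⟩
        - ∑ (μ π ∘ proj₁) [ π , σ ⟩
          ≡⟨ cong -_ (∑-cong (λ (z , π≤z , z<σ) → go z (rec {z} z<σ) (blockOf z) π≤z) [ π , σ ⟩) ⟩
        - ∑ (möbius ∘ offsetOf ∘ proj₁) [ π , σ ⟩
          ≡⟨ cong (-_ ∘ sumℤ) (List.map-∘ [ π , σ ⟩) ⟩
        - ∑ möbius (List.map (offsetOf ∘ proj₁) [ π , σ ⟩)
          ≡⟨ +≡0⇒≡- _ _ (trans (∑-möbius (offset-balanced π≼σ) (interval-enumerates σ bσ π≤σ))
               (δ-≢0 (offset bπ bσ) λ eq → π≉σ (offset-injective (≤ᴮ⇒≼ bπ bπ (done λ _ → refl)) π≼σ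
                 (trans (offset-self bπ) (sym eq))))) ⟨
        möbius (offset bπ bσ) ∎
        where
        open ≡-Reasoning
        π≼σ = ≤ᴮ⇒≼ bπ bσ π≤σ

-- From offsets to differences of length vectors

Values : (d₁ d₂ d₃ d₄ : ℕ) → ℤ → Set
Values d₁ d₂ d₃ d₄ m =
    (Case₁ d₁ d₂ d₃ d₄ → m ≡ + 1)
  × (Case₂ d₁ d₂ d₃ d₄ → m ≡ - (+ 1))
  × (Case₃ d₁ d₂ d₃ d₄ → m ≡ + 3)
  × (Case₄ d₁ d₂ d₃ d₄ → m ≡ + 4)
  × (Case₅ d₁ d₂ d₃ d₄ → m ≡ + 1)
  × (Case₆ d₁ d₂ d₃ d₄ → m ≡ - (+ 2))
  × (¬ Case₁ d₁ d₂ d₃ d₄ → ¬ Case₂ d₁ d₂ d₃ d₄ → ¬ Case₃ d₁ d₂ d₃ d₄ →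
     ¬ Case₄ d₁ d₂ d₃ d₄ → ¬ Case₅ d₁ d₂ d₃ d₄ → ¬ Case₆ d₁ d₂ d₃ d₄ → m ≡ + 0)

möbius-values : ∀ x₁ x₂ x₃ x₄ {d₁ d₂ d₃ d₄ m} → d₁ ≡ suc x₁ → d₂ ≡ suc x₂ → d₃ ≡ suc x₃ → d₄ ≡ suc x₄ →
                m ≡ möbius (x₁ , x₂ , x₃ , x₄) → Values d₁ d₂ d₃ d₄ m
möbius-values x₁ x₂ x₃ x₄ refl refl refl refl refl =
    möbius-case₁ x₁ x₂ x₃ x₄ , möbius-case₂ x₁ x₂ x₃ x₄ , möbius-case₃ x₁ x₂ x₃ x₄
  , möbius-case₄ x₁ x₂ x₃ x₄ , möbius-case₅ x₁ x₂ x₃ x₄ , möbius-case₆ x₁ x₂ x₃ x₄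
  , none (möbius-cases x₁ x₂ x₃ x₄)
  where
  none : ∀ {m : ℤ} {A B C D E F : Set} → m ≡ 0ℤ ⊎ A ⊎ B ⊎ C ⊎ D ⊎ E ⊎ F →
         ¬ A → ¬ B → ¬ C → ¬ D → ¬ E → ¬ F → m ≡ 0ℤ
  none (inj₁ m≡0)      _  _  _  _  _  _  = m≡0
  none (inj₂ (in₁ p)) ¬p _  _  _  _  _  = contradiction p ¬p
  none (inj₂ (in₂ p)) _  ¬p _  _  _  _  = contradiction p ¬p
  none (inj₂ (in₃ p)) _  _  ¬p _  _  _  = contradiction p ¬p
  none (inj₂ (in₄ p)) _  _  _  ¬p _  _  = contradiction p ¬p
  none (inj₂ (in₅ p)) _  _  _  _  ¬p _  = contradiction p ¬p
  none (inj₂ (in₆ p)) _  _  _  _  _  ¬p = contradiction p ¬p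

∣m-n∣+1 : ∀ {m n} → n ≤ m → ∣ m - n ∣ + 1 ≡ suc (m ∸ n)
∣m-n∣+1 n≤m = trans (cong (_+ 1) (ℕ.m≤n⇒∣n-m∣≡n∸m n≤m)) (ℕ.+-comm _ 1)

∣n-m∣+1 : ∀ {m n} → n ≤ m → ∣ n - m ∣ + 1 ≡ suc (m ∸ n)
∣n-m∣+1 {m} {n} n≤m = trans (cong (_+ 1) (ℕ.∣-∣-comm n m)) (∣m-n∣+1 n≤m)

∣m+1-n+1∣+1 : ∀ {m n} → n ≤ m → ∣ m + 1 - n + 1 ∣ + 1 ≡ suc (m ∸ n)
∣m+1-n+1∣+1 {m} {n} n≤m = trans
  (cong (_+ 1) (trans (cong₂ ∣_-_∣ (ℕ.+-comm m 1) (ℕ.+-comm n 1)) refl)) (∣m-n∣+1 n≤m)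

theorem3p10 : (n : ℕ) → 1 ≤ n →
    let module B = FinitePoset (𝔅 n)
        open Möbius (𝔅 n) using (μ)
    in
    (π σ : B.Carrier) →
    (ℓ₁ ℓ₂ ℓ₃ ℓ₄ : ℕ) → HasLengthVector (proj₁ π) ℓ₁ ℓ₂ ℓ₃ ℓ₄ →
    (m₁ m₂ m₃ m₄ : ℕ) → HasLengthVector (proj₁ σ) m₁ m₂ m₃ m₄ →
    π B.≤ σ →
    let d₁ = ∣ ℓ₁ - m₁ ∣ + 1
        d₂ = ∣ ℓ₂ - m₂ ∣ + 1
        d₃ = ∣ ℓ₃ - m₃ ∣ + 1
        d₄ = ∣ ℓ₄ - m₄ ∣ + 1
    in
      (Case₁ d₁ d₂ d₃ d₄ → μ π σ ≡ + 1)
    × (Case₂ d₁ d₂ d₃ d₄ → μ π σ ≡ - (+ 1))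
    × (Case₃ d₁ d₂ d₃ d₄ → μ π σ ≡ + 3)
    × (Case₄ d₁ d₂ d₃ d₄ → μ π σ ≡ + 4)
    × (Case₅ d₁ d₂ d₃ d₄ → μ π σ ≡ + 1)
    × (Case₆ d₁ d₂ d₃ d₄ → μ π σ ≡ - (+ 2))
    × (¬ Case₁ d₁ d₂ d₃ d₄ → ¬ Case₂ d₁ d₂ d₃ d₄ → ¬ Case₃ d₁ d₂ d₃ d₄ →
       ¬ Case₄ d₁ d₂ d₃ d₄ → ¬ Case₅ d₁ d₂ d₃ d₄ → ¬ Case₆ d₁ d₂ d₃ d₄ →
       μ π σ ≡ + 0)
theorem3p10 n _ π σ _ _ _ _ πℓ _ _ _ _ σm π≤σ
  with bπ , refl , refl , refl , refl ← lengthVector⇒block {ω = proj₁ π} πℓ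
     | bσ , refl , refl , refl , refl ← lengthVector⇒block {ω = proj₁ σ} σm =
  -- The order fixes the signs: π has the larger first and last lengths, σ the larger middle ones.
  -- So each dᵢ is one more than the matching entry of the offset.
  let open _≼_ (≤ᴮ⇒≼ bπ bσ π≤σ) in
  möbius-values _ _ _ _ (∣m+1-n+1∣+1 a≥) (∣n-m∣+1 h≤) (∣n-m∣+1 k≤) (∣m+1-n+1∣+1 l≥) (μ≡möbius π bπ σ bσ π≤σ)
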